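{- Let $n\ge 3$ be an integer. Then: \begin{itemize} \item $C_n$ is $3,2$-perfect. \item $C_n$ is $3,3$-perfect if and only if $n<7$ or ($n\ge 7$ and $2\mid n$). \item $C_n$ is $3,4$-perfect if and only if $n\ne 7$. \item $C_n$ is $3,5$-perfect if and only if ($n<10$ and $n\ne 7$) or ($n\ge 10$ and $3\mid n$). \item $C_n$ is $3,6$-perfect if and only if $n\notin\{7,10,11,13,17\}$. \item $C_n$ is $3,7$-perfect if and only if ($n<14$ and $n\notin\{7,10,11,13\}$) or ($n\ge 14$ and $4\mid n$). \item $C_n$ is $3,8$-perfect if and only if $n\notin\{7,10,11,13,14,15,16,17,21,22,26,31\}$. \item $C_n$ is $3,9$-perfect if and only if ($n<18$ and $n\notin\{7,10,11,13,14,15,16,17\}$) or ($n\ge 18$ and $5\mid n$). \end{itemize}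
   Context: $C_n$ is the cycle graph on $n$ vertices. All graphs are simple and undirected with nonempty vertex set. A shortest path in a graph $G$ is a path between some vertices $u,v$ whose length (number of edges) equals the graph distance between $u$ and $v$. A set $S\subseteq V(G)$ is $k,d$-independent in $G$ if every shortest path in $G$ of length at most $d$ contains fewer than $k$ vertices of $S$. The $k,d$-chromatic number $\chi^k_d(G)$ is the least positive integer $c$ such that some coloring $V(G)\to\{1,\dots,c\}$ has all color classes $k,d$-independent. A set $S\subseteq V(G)$ is a $k,d$-clique in $G$ if every $k$-element subset of $S$ is contained in some shortest path of $G$ of length at most $d$ (sets with fewer than $k$ elements are vacuously $k,d$-cliques); $\omega^k_d(G)$ is the supremum of the sizes of $k,d$-cliques in $G$. For $2\le k\le d+1$, $G$ is $k,d$-perfect if $\chi^k_d(H)=\left\lceil\frac{\omega^k_d(H)}{k-1}\right\rceil$ for every induced subgraph $H$ of $G$ (shortest paths being computed in $H$). -}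

module Defs where

open import Data.Fin.Base using (Fin; toℕ)
import Data.Fin.Properties as Fin
open import Data.Fin.Subset using (Subset; _⊆_; ∣_∣) renaming (_∈_ to _∈ₛ_)
open import Data.Fin.Subset.Properties using (_∈?_)
open import Data.Nat.Base
open import Data.Nat.DivMod using (_/_; _%_; m<n⇒m%n≡m; n%n≡0)
open import Data.Nat.Properties
  using (m<n⇒0<n∸m; m≤n⇒m<n∨m≡n; 1+n≢n; ≤-trans; _≤?_)
open import Data.Product.Base using (∃-syntax; Σ-syntax; _×_)
open import Data.Sum.Base using (_⊎_; inj₁; inj₂; swap)
open import Data.Vec.Base using (Vec; head; last; count; tabulate)
open import Data.Vec.Membership.Propositional using (_∈_)
open import Data.Vec.Relation.Unary.Linked using (Linked)
open import Data.Vec.Relation.Unary.Unique.Propositional using (Unique)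
open import Function.Bundles using (_↣_; Injection)
open import Relation.Binary.Definitions using (Symmetric)
open import Relation.Binary.PropositionalEquality
  using (_≡_; refl; sym; trans)
open import Relation.Nullary using (¬_; does)
open import Relation.Nullary.Decidable using (True; toWitness)

record Graph (n : ℕ) : Set₁ where
  field
    Adj         : Fin n → Fin n → Set
    symmetric   : Symmetric Adj
    irreflexive : ∀ v → ¬ Adj v v

-- An induced subgraph is presented by an enumeration without repetition of its
-- vertices, so that its vertex set is again some Fin m.
induced : ∀ {m n} → Graph n → Fin m ↣ Fin n → Graph m
induced G f = record
  { Adj         = λ u v → Adj (to u) (to v)
  ; symmetric   = symmetric
  ; irreflexive = λ v → irreflexive (to v)
  }
  where
  open Graph G
  open Injection f using (to)

module _ {n : ℕ} (G : Graph n) where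

  open Graph G

  -- A path of length ℓ is given by its ℓ + 1 vertices in order.
  record IsPath {ℓ : ℕ} (u v : Fin n) (p : Vec (Fin n) (suc ℓ)) : Set where
    field
      starts   : head p ≡ u
      ends     : last p ≡ v
      linked   : Linked Adj p
      distinct : Unique p

  -- Vertices in different components have no (finite) distance.
  IsDistance : Fin n → Fin n → ℕ → Set
  IsDistance u v δ =
      (Σ[ p ∈ Vec (Fin n) (suc δ) ] IsPath u v p)
    × (∀ {ℓ} (p : Vec (Fin n) (suc ℓ)) → IsPath u v p → δ ≤ ℓ)

  IsShortestPath : ∀ {ℓ} → Vec (Fin n) (suc ℓ) → Set
  IsShortestPath {ℓ} p = ∃[ u ] ∃[ v ] IsPath u v p × IsDistance u v ℓ

  -- The vertices of a path are distinct, so counting positions counts vertices.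
  IsIndependent : (k d : ℕ) → Subset n → Set
  IsIndependent k d S =
    ∀ {ℓ} (p : Vec (Fin n) (suc ℓ)) → IsShortestPath p → ℓ ≤ d →
    count (_∈? S) p < k

  colourClass : ∀ {c} → (Fin n → Fin c) → Fin c → Subset n
  colourClass f i = tabulate λ v → does (f v Fin.≟ i)

  Colourable : (k d c : ℕ) → Set
  Colourable k d c =
    Σ[ f ∈ (Fin n → Fin c) ] ∀ i → IsIndependent k d (colourClass f i)

  IsChromaticNumber : (k d χ : ℕ) → Set
  IsChromaticNumber k d χ =
    0 < χ × Colourable k d χ × (∀ c → 0 < c → Colourable k d c → χ ≤ c)

  IsClique : (k d : ℕ) → Subset n → Set
  IsClique k d S =
    ∀ T → T ⊆ S → ∣ T ∣ ≡ k →
    ∃[ ℓ ] Σ[ p ∈ Vec (Fin n) (suc ℓ) ]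
      IsShortestPath p × ℓ ≤ d × (∀ {v} → v ∈ₛ T → v ∈ p)

  -- The number of vertices being finite, the supremum is a maximum.
  IsCliqueNumber : (k d ω : ℕ) → Set
  IsCliqueNumber k d ω =
      (∃[ S ] IsClique k d S × ∣ S ∣ ≡ ω)
    × (∀ S → IsClique k d S → ∣ S ∣ ≤ ω)

⌈_/_⌉ : (a b : ℕ) .{{_ : NonZero b}} → ℕ
⌈ a / b ⌉ = (a + (b ∸ 1)) / b

k∸1≢0 : ∀ {k} → 2 ≤ k → NonZero (k ∸ 1)
k∸1≢0 2≤k = >-nonZero (m<n⇒0<n∸m 2≤k)

-- χ and ω are relations here; both are single-valued, and requiring values to
-- exist keeps the equation from holding vacuously.
Perfect : (k d : ℕ) {2≤k : True (2 ≤? k)} {k≤d+1 : True (k ≤? d + 1)} →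
          ∀ {n} → Graph n → Set
Perfect k d {2≤k} {n = n} G =
  ∀ {m} .{{_ : NonZero m}} (f : Fin m ↣ Fin n) →
  let H = induced G f in
  ∃[ χ ] ∃[ ω ] IsChromaticNumber H k d χ × IsCliqueNumber H k d ω
    × χ ≡ ⌈ ω / k ∸ 1 ⌉ {{k∸1≢0 (toWitness 2≤k)}}

module _ (n : ℕ) .{{_ : NonZero n}} where

  CycleAdj : Fin n → Fin n → Set
  CycleAdj i j = suc (toℕ i) % n ≡ toℕ j ⊎ suc (toℕ j) % n ≡ toℕ i

suc%n≢ : ∀ {n i} .{{_ : NonZero n}} → 3 ≤ n → i < n → ¬ (suc i % n ≡ i)
suc%n≢ {n} {i} 3≤n i<n eq with m≤n⇒m<n∨m≡n i<n
... | inj₁ 1+i<n = 1+n≢n (trans (sym (m<n⇒m%n≡m 1+i<n)) eq)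
... | inj₂ refl with trans (sym (n%n≡0 (suc i))) eq
suc%n≢ (s≤s ()) i<n eq | inj₂ refl | refl

cycle : ∀ n → 3 ≤ n → Graph n
cycle n 3≤n = record
  { Adj         = CycleAdj n
  ; symmetric   = swap
  ; irreflexive = λ where
      v (inj₁ eq) → suc%n≢ 3≤n (Fin.toℕ<n v) eq
      v (inj₂ eq) → suc%n≢ 3≤n (Fin.toℕ<n v) eq
  }
  where
  instance
    n≢0 : NonZero n
    n≢0 = >-nonZero (≤-trans (s≤s z≤n) 3≤n)

{-# OPTIONS --safe #-}
module Submission where

-- Put D = min (d, ⌊n / 2⌋), Q = ⌊2n / (D + 1)⌋ and c = ⌈(D + 1) / 2⌉. The maximal
-- shortest paths to consider in C_n are the windows of D + 1 consecutive vertices,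
-- and the cliques of C_n have at most 2c elements, so that perfection of C_n itself
-- amounts to a colouring with c colours. Counting the vertices of one colour over
-- all windows shows that a colour class has at most Q elements, so n ≤ cQ is
-- necessary. It is also sufficient: the colouring i ↦ ⌊i cQ / n⌋ mod c is well
-- defined modulo n, and ⌊i cQ / n⌋ increases strictly with i, but by less than 2c
-- over any D steps.
--
-- A proper induced subgraph is a disjoint union of paths. Cut at a missing vertex,
-- its vertices are numbered linearly, and the number modulo ⌈w / 2⌉ is an optimal
-- colouring if w is the largest number of vertices of a shortest path of length
-- at most d. In both cases the clique number is found by a finite search, as
-- w ≤ ω ≤ 2 χ already determines ⌈ω / 2⌉.

open import Defs
open import Data.Nat using (ℕ; _≤_; _<_; _≥_)
open import Data.Nat.Divisibility using (_∣_; ∣⇒≤; m%n≡0⇒n∣m; m∣m*n; n∣m*n)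
open import Data.List using (List; []; _∷_)
open import Data.List.Membership.Propositional using (_∉_)
open import Data.Product using (_×_)
open import Data.Sum using (_⊎_)
open import Function.Bundles using (_⇔_; _↣_; Equivalence; Injection; mk⇔)
open import Relation.Binary.PropositionalEquality

import Algebra.Properties.CommutativeMonoid.Sum
open import Data.Bool.Base using (if_then_else_)
open import Data.Empty using (⊥; ⊥-elim)
open import Data.Fin.Base using (Fin; zero; suc; toℕ)
import Data.Fin.Properties as Fin
open import Data.Fin.Subset using (Subset; inside; outside; _⊆_; ∣_∣)
  renaming (_∈_ to _∈ₛ_; ⊥ to ∅)
open import Data.Fin.Subset.Properties
  using (∉⊥; ∣⊥∣≡0; anySubset?; _⊆?_) renaming (_∈?_ to _∈ₛ?_)
import Data.List.Membership.DecPropositional as ListMembership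
import Data.List.Relation.Unary.All as List
open import Data.Nat.Base hiding (_≤_; _<_; _≥_)
open import Data.Nat.DivMod
open import Data.Nat.Induction using (<-wellFounded)
open import Data.Nat.Properties
open import Data.Nat.Tactic.RingSolver using (solve-∀)
open import Data.Product.Base using (Σ-syntax; ∃-syntax; ∃; _,_; proj₁; proj₂; map₂)
open import Data.Sum.Base using (inj₁; inj₂; map₁)
open import Data.Unit.Base using (⊤; tt)
open import Data.Vec.Base using (Vec; []; _∷_; count; tabulate; here; there; head; last; map; _[_]≔_)
open import Data.Vec.Membership.Propositional using (_∈_)
import Data.Vec.Membership.DecPropositional as Membership
open import Data.Vec.Properties
  using (lookup∘tabulate; lookup⇒[]=; []=⇒lookup; []≔-updates; []≔-minimal; lookup∘update′)
open import Data.Vec.Relation.Unary.All as All using (All; []; _∷_)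
import Data.Vec.Relation.Unary.All.Properties as All
open import Data.Vec.Relation.Unary.AllPairs using ([]; _∷_; allPairs?)
import Data.Vec.Relation.Unary.Any as Any
open import Data.Vec.Relation.Unary.Linked using (Linked; linked?; [-]; _∷_)
open import Data.Vec.Relation.Unary.Unique.Propositional using (Unique)
import Data.Vec.Relation.Unary.Unique.Propositional.Properties as Unique
open import Function.Base using (_∘_; id; flip)
open import Function.Construct.Composition using (_⇔-∘_)
open import Function.Construct.Identity using (↣-id)
open import Induction.WellFounded using (Acc; acc)
open import Level using (0ℓ)
open import Relation.Binary.Core using (Rel)
open import Relation.Binary.Definitions using (DecidableEquality; tri<; tri≈; tri>)
import Relation.Binary.Definitions as B
open import Relation.Nullary
open import Relation.Nullary.Decidable
  using (_×-dec_; _⊎-dec_; _→-dec_; ¬?; map′; decidable-stable; dec-true; True; toWitness)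
open import Relation.Unary using (Pred; Decidable)

open Algebra.Properties.CommutativeMonoid.Sum +-0-commutativeMonoid
  using (sum; sum-cong-≗; ∑-comm; ∑-distrib-+)

-- Counting in vectors

𝟙 : ∀ {P : Set} → Dec P → ℕ
𝟙 P? = if does P? then 1 else 0

sum≤ : ∀ {n b} (g : Fin n → ℕ) → (∀ i → g i ≤ b) → sum g ≤ n * b
sum≤ {zero}  g g≤b = z≤n
sum≤ {suc n} g g≤b = +-mono-≤ (g≤b zero) (sum≤ (g ∘ suc) (g≤b ∘ suc))

sum-const : ∀ n b → sum {n} (λ _ → b) ≡ n * b
sum-const zero    b = refl
sum-const (suc n) b = cong (b +_) (sum-const n b)

sum-𝟙-≡ : ∀ {c} (j : Fin c) → sum (λ i → 𝟙 (j Fin.≟ i)) ≡ 1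
sum-𝟙-≡ {suc c} zero    = cong suc (trans (sum-const c 0) (*-zeroʳ c))
sum-𝟙-≡ {suc c} (suc j) = trans (sum-cong-≗ λ i → step i) (sum-𝟙-≡ j)
  where
  step : ∀ i → 𝟙 (suc j Fin.≟ suc i) ≡ 𝟙 (j Fin.≟ i)
  step i with j Fin.≟ i
  ... | yes _ = refl
  ... | no  _ = refl

module _ {A : Set} where

  count-∷ : {P : Pred A 0ℓ} (P? : Decidable P) →
            ∀ {n} x (xs : Vec A n) → count P? (x ∷ xs) ≡ 𝟙 (P? x) + count P? xs
  count-∷ P? x xs with P? x
  ... | yes _ = refl
  ... | no  _ = refl

  count-mono : {P Q : Pred A 0ℓ} (P? : Decidable P) (Q? : Decidable Q) →
               (∀ {x} → P x → Q x) → ∀ {n} (xs : Vec A n) → count P? xs ≤ count Q? xs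
  count-mono P? Q? P⇒Q []       = z≤n
  count-mono P? Q? P⇒Q (x ∷ xs) with P? x | Q? x
  ... | yes _ | yes _ = s≤s (count-mono P? Q? P⇒Q xs)
  ... | yes p | no ¬q = contradiction (P⇒Q p) ¬q
  ... | no  _ | yes _ = m≤n⇒m≤1+n (count-mono P? Q? P⇒Q xs)
  ... | no  _ | no  _ = count-mono P? Q? P⇒Q xs

  count-tabulate : {P : Pred A 0ℓ} (P? : Decidable P) →
                   ∀ {n} (h : Fin n → A) → count P? (tabulate h) ≡ sum (λ i → 𝟙 (P? (h i)))
  count-tabulate P? {zero}  h = refl
  count-tabulate P? {suc n} h =
    trans (count-∷ P? (h zero) (tabulate (h ∘ suc))) (cong (𝟙 (P? (h zero)) +_) (count-tabulate P? (h ∘ suc)))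

  -- The transfer of `All Q` is stated for every `Q`, because distinctness is an `All` statement
  -- whose predicate changes from entry to entry.
  select : {P : Pred A 0ℓ} (P? : Decidable P) → ∀ {n} (xs : Vec A n) →
           Σ[ ys ∈ Vec A (count P? xs) ]
             All P ys × (∀ {Q : Pred A 0ℓ} → All Q xs → All Q ys) × (Unique xs → Unique ys)
  select P? [] = [] , [] , (λ _ → []) , (λ _ → [])
  select P? (x ∷ xs) with P? x | select P? xs
  ... | yes p | ys , ps , sub , uniq = x ∷ ys , p ∷ ps , (λ where (q ∷ qs) → q ∷ sub qs)
                                     , (λ where (d ∷ ds) → sub d ∷ uniq ds)
  ... | no _  | ys , ps , sub , uniq = ys , ps , (λ where (q ∷ qs) → sub qs)
                                     , (λ where (d ∷ ds) → uniq ds)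

  module _ (_≟_ : DecidableEquality A) where

    count-remove : {P : Pred A 0ℓ} (P? : Decidable P) → ∀ {n} {xs : Vec A n} {a} →
                   a ∈ xs → P a → count (λ x → P? x ×-dec ¬? (a ≟ x)) xs < count P? xs
    count-remove {P} P? {xs = x ∷ xs} {a} (Any.here refl) pa with P? a | a ≟ a
    ... | no ¬p | _     = contradiction pa ¬p
    ... | yes _ | no ¬e = contradiction refl ¬e
    ... | yes _ | yes _ = s≤s (count-mono _ P? proj₁ xs)
    count-remove P? {xs = x ∷ xs} {a} (Any.there a∈) pa with P? x | a ≟ x
    ... | yes _ | yes _ = m≤n⇒m≤1+n (count-remove P? a∈ pa)
    ... | yes _ | no  _ = s≤s (count-remove P? a∈ pa)
    ... | no  _ | yes _ = count-remove P? a∈ pa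
    ... | no  _ | no  _ = count-remove P? a∈ pa

    -- Induction on `ys`: its head is struck out of the predicate, which lowers the count by at
    -- least one, and the later entries still qualify since they differ from the head.
    length≤count : {P : Pred A 0ℓ} (P? : Decidable P) → ∀ {n k} {xs : Vec A n} {ys : Vec A k} →
                   Unique ys → All (_∈ xs) ys → All P ys → k ≤ count P? xs
    length≤count P? [] [] [] = z≤n
    length≤count P? (d ∷ ds) (i ∷ is) (p ∷ ps) =
      ≤-trans (s≤s (length≤count _ ds is (All.zip (ps , d)))) (count-remove P? i p)

  sum-count : ∀ {c} (f : A → Fin c) → ∀ {n} (xs : Vec A n) →
              sum (λ i → count (λ x → f x Fin.≟ i) xs) ≡ n
  sum-count {c} f []       = trans (sum-const c 0) (*-zeroʳ c)
  sum-count f {suc n} (x ∷ xs) = begin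
    sum (λ i → count (λ y → f y Fin.≟ i) (x ∷ xs))
      ≡⟨ sum-cong-≗ (λ i → count-∷ (λ y → f y Fin.≟ i) x xs) ⟩
    sum (λ i → 𝟙 (f x Fin.≟ i) + count (λ y → f y Fin.≟ i) xs)
      ≡⟨ ∑-distrib-+ (λ i → 𝟙 (f x Fin.≟ i)) (λ i → count (λ y → f y Fin.≟ i) xs) ⟩
    sum (λ i → 𝟙 (f x Fin.≟ i)) + sum (λ i → count (λ y → f y Fin.≟ i) xs)
      ≡⟨ cong₂ _+_ (sum-𝟙-≡ (f x)) (sum-count f xs) ⟩
    suc n ∎
    where open ≡-Reasoning

  pigeonhole : ∀ {c b} (f : A → Fin c) → ∀ {n} (xs : Vec A n) →
               (∀ i → count (λ x → f x Fin.≟ i) xs ≤ b) → n ≤ c * b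
  pigeonhole {c} {b} f xs bound =
    subst (_≤ c * b) (sum-count f xs) (sum≤ _ bound)

  unique-injection : ∀ {c} (f : A → Fin c) → ∀ {n} {xs : Vec A n} (P : Pred A 0ℓ) → Unique xs → All P xs →
                (∀ {x y} → P x → P y → f x ≡ f y → x ≡ y) → n ≤ c
  unique-injection {c} f {xs = xs} P u ps inj = subst (_ ≤_) (*-identityʳ c) (pigeonhole f xs bound)
    where
    bound : ∀ i → count (λ x → f x Fin.≟ i) xs ≤ 1
    bound i with count (λ x → f x Fin.≟ i) xs | select (λ x → f x Fin.≟ i) xs
    ... | 0 | _ = z≤n
    ... | 1 | _ = ≤-refl
    ... | suc (suc _) | (a ∷ b ∷ _) , (fa ∷ fb ∷ _) , sub , uniq with sub ps | uniq u
    ... | pa ∷ pb ∷ _ | (a≢b ∷ _) ∷ _ = contradiction (inj pa pb (trans fa (sym fb))) a≢b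

-- Subsets and graphs

infix 4 _∈ᵥ?_
_∈ᵥ?_ : ∀ {m k} (x : Fin m) (p : Vec (Fin m) k) → Dec (x ∈ p)
x ∈ᵥ? p = Membership._∈?_ Fin._≟_ x p

∈-self : ∀ {A : Set} {k} {p : Vec A k} → All (_∈ p) p
∈-self {p = []}    = []
∈-self {p = _ ∷ _} = Any.here refl ∷ All.map Any.there ∈-self

elements : ∀ {m} (S : Subset m) → Σ[ xs ∈ Vec (Fin m) ∣ S ∣ ] Unique xs × All (_∈ₛ S) xs
elements []            = [] , [] , []
elements (inside ∷ S) with xs , u , xs∈ ← elements S =
    zero ∷ map suc xs
  , All.map⁺ (All.universal (λ _ ()) xs) ∷ Unique.map⁺ Fin.suc-injective u
  , here ∷ All.map⁺ (All.map there xs∈)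
elements (outside ∷ S) with xs , u , xs∈ ← elements S =
  map suc xs , Unique.map⁺ Fin.suc-injective u , All.map⁺ (All.map there xs∈)

fromVec : ∀ {m k} → Vec (Fin m) k → Subset m
fromVec []       = ∅
fromVec (x ∷ xs) = fromVec xs [ x ]≔ inside

∈-fromVec⁺ : ∀ {m k} {x : Fin m} (xs : Vec (Fin m) k) → x ∈ xs → x ∈ₛ fromVec xs
∈-fromVec⁺ {x = x} (y ∷ xs) x∈ with x Fin.≟ y
∈-fromVec⁺ (y ∷ xs) x∈               | yes refl = []≔-updates (fromVec xs) y
∈-fromVec⁺ (y ∷ xs) (Any.here x≡y)   | no x≢y = contradiction x≡y x≢y
∈-fromVec⁺ {x = x} (y ∷ xs) (Any.there x∈) | no x≢y =
  []≔-minimal (fromVec xs) x y x≢y (∈-fromVec⁺ xs x∈)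

∈-fromVec⁻ : ∀ {m k} {x : Fin m} (xs : Vec (Fin m) k) → x ∈ₛ fromVec xs → x ∈ xs
∈-fromVec⁻ []       x∈ = contradiction x∈ ∉⊥
∈-fromVec⁻ {x = x} (y ∷ xs) x∈ with x Fin.≟ y
... | yes x≡y = Any.here x≡y
... | no  x≢y = Any.there (∈-fromVec⁻ xs (lookup⇒[]= x (fromVec xs)
                  (trans (sym (lookup∘update′ x≢y (fromVec xs) inside)) ([]=⇒lookup x∈))))

∣insert∣ : ∀ {m} (x : Fin m) (S : Subset m) → ¬ x ∈ₛ S → ∣ S [ x ]≔ inside ∣ ≡ suc ∣ S ∣
∣insert∣ zero    (inside  ∷ S) x∉ = contradiction here x∉
∣insert∣ zero    (outside ∷ S) x∉ = refl
∣insert∣ (suc x) (inside  ∷ S) x∉ = cong suc (∣insert∣ x S (x∉ ∘ there))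
∣insert∣ (suc x) (outside ∷ S) x∉ = ∣insert∣ x S (x∉ ∘ there)

∣fromVec∣ : ∀ {m k} {xs : Vec (Fin m) k} → Unique xs → ∣ fromVec xs ∣ ≡ k
∣fromVec∣ {m} []       = ∣⊥∣≡0 m
∣fromVec∣ {xs = x ∷ xs} (d ∷ ds) =
  trans (∣insert∣ x (fromVec xs) λ x∈ → All.lookup d (∈-fromVec⁻ xs x∈) refl) (cong suc (∣fromVec∣ ds))

∃Vec? : ∀ {m} k {P : Pred (Vec (Fin m) k) 0ℓ} → Decidable P → Dec (∃ P)
∃Vec? zero    P? = map′ ([] ,_) (λ where ([] , p) → p) (P? [])
∃Vec? (suc k) P? = map′ (λ (x , xs , p) → x ∷ xs , p) (λ where (x ∷ xs , p) → x , xs , p)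
                        (Fin.any? λ x → ∃Vec? k (P? ∘ (x ∷_)))

-- For k = 3 the quotient in the definition of perfection unfolds to `(w + 1) / 2`. Together with
-- the next lemma: ⌈w / 2⌉ ≤ c exactly if w ≤ 2c.
≤⌈/2⌉*2 : ∀ w → w ≤ (w + 1) / 2 * 2
≤⌈/2⌉*2 w = s≤s⁻¹ (begin
  suc w                             ≡⟨ +-comm 1 w ⟩
  w + 1                             ≡⟨ m≡m%n+[m/n]*n (w + 1) 2 ⟩
  (w + 1) % 2 + (w + 1) / 2 * 2     ≤⟨ +-monoˡ-≤ _ (s≤s⁻¹ (m%n<n (w + 1) 2)) ⟩
  1 + (w + 1) / 2 * 2               ∎)
  where open ≤-Reasoning

⌈/2⌉≤ : ∀ {w c} → w ≤ c * 2 → (w + 1) / 2 ≤ c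
⌈/2⌉≤ {w} {c} w≤2c = s≤s⁻¹ (m<n*o⇒m/o<n (begin-strict
  w + 1       ≤⟨ +-monoˡ-≤ 1 w≤2c ⟩
  c * 2 + 1   ≡⟨ +-comm (c * 2) 1 ⟩
  1 + c * 2   <⟨ ≤-refl ⟩
  2 + c * 2   ∎))
  where open ≤-Reasoning

-- Colourings, cliques and their decidability in a finite graph

module _ {m} (G : Graph m) where
  open Graph G

  ∈-colourClass⁺ : ∀ {c} (f : Fin m → Fin c) {i v} → f v ≡ i → v ∈ₛ colourClass G f i
  ∈-colourClass⁺ f {i} {v} eq = lookup⇒[]= v _
    (trans (lookup∘tabulate _ v) (dec-true (f v Fin.≟ i) eq))

  ∈-colourClass⁻ : ∀ {c} (f : Fin m → Fin c) {i v} → v ∈ₛ colourClass G f i → f v ≡ i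
  ∈-colourClass⁻ f {i} {v} v∈
    with f v Fin.≟ i | trans (sym (lookup∘tabulate (λ u → does (f u Fin.≟ i)) v)) ([]=⇒lookup v∈)
  ... | yes eq | _ = eq
  ... | no _   | ()

  count-colourClass : ∀ {c} (f : Fin m → Fin c) i {k} (p : Vec (Fin m) k) →
                      count (_∈ₛ? colourClass G f i) p ≡ count (λ v → f v Fin.≟ i) p
  count-colourClass f i p = ≤-antisym
    (count-mono _ _ (∈-colourClass⁻ f) p) (count-mono _ _ (∈-colourClass⁺ f) p)

  length≤2χ : ∀ {d c ℓ} {p : Vec (Fin m) (suc ℓ)} → Colourable G 3 d c →
              IsShortestPath G p → ℓ ≤ d → suc ℓ ≤ c * 2
  length≤2χ {p = p} (f , indep) sp ℓ≤d = pigeonhole f p λ i →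
    s≤s⁻¹ (subst (_< 3) (count-colourClass f i p) (indep i p sp ℓ≤d))

  -- Three elements of a clique in one colour would lie on a common shortest path of length at most
  -- d, which would then meet that colour class three times.
  clique≤2χ : ∀ {d c} {S : Subset m} → Colourable G 3 d c → IsClique G 3 d S → ∣ S ∣ ≤ c * 2
  clique≤2χ {d} {c} {S} (f , indep) clique with xs , uniq , xs∈S ← elements S = pigeonhole f xs bound
    where
    bound : ∀ i → count (λ v → f v Fin.≟ i) xs ≤ 2
    bound i with count (λ v → f v Fin.≟ i) xs | select (λ v → f v Fin.≟ i) xs
    ... | 0 | _ = z≤n
    ... | 1 | _ = s≤s z≤n
    ... | 2 | _ = ≤-refl
    ... | suc (suc (suc _)) | a ∷ b ∷ e ∷ _ , (fa ∷ fb ∷ fe ∷ _) , sub , uniq′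
      with (a≢b ∷ a≢e ∷ _) ∷ (b≢e ∷ _) ∷ _ ← uniq′ uniq
         | a∈ ∷ b∈ ∷ e∈ ∷ _ ← sub xs∈S = contradiction three (<⇒≱ (indep i p shortest ℓ≤d))
      where
      t = a ∷ b ∷ e ∷ []
      t-unique : Unique t
      t-unique = (a≢b ∷ a≢e ∷ []) ∷ (b≢e ∷ []) ∷ [] ∷ []
      t∈S : All (_∈ₛ S) t
      t∈S = a∈ ∷ b∈ ∷ e∈ ∷ []
      path = clique (fromVec t) (λ v∈ → All.lookup t∈S (∈-fromVec⁻ t v∈)) (∣fromVec∣ t-unique)
      p = path .proj₂ .proj₁
      shortest = path .proj₂ .proj₂ .proj₁
      ℓ≤d = path .proj₂ .proj₂ .proj₂ .proj₁
      three : 3 ≤ count (_∈ₛ? colourClass G f i) p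
      three = length≤count Fin._≟_ _ t-unique
        (All.map (λ v∈t → path .proj₂ .proj₂ .proj₂ .proj₂ (∈-fromVec⁺ t v∈t)) ∈-self)
        (∈-colourClass⁺ f fa ∷ ∈-colourClass⁺ f fb ∷ ∈-colourClass⁺ f fe ∷ [])

  path-clique : ∀ {k d ℓ} {p : Vec (Fin m) (suc ℓ)} → IsShortestPath G p → ℓ ≤ d →
                IsClique G k d (fromVec p)
  path-clique {p = p} sp ℓ≤d T T⊆p _ = _ , p , sp , ℓ≤d , λ v∈T → ∈-fromVec⁻ p (T⊆p v∈T)

  module Decide (adj? : B.Decidable Adj) where

    isPath? : ∀ {ℓ} u v (p : Vec (Fin m) (suc ℓ)) → Dec (IsPath G u v p)
    isPath? u v p = map′
      (λ (s , e , l , u) → record { starts = s ; ends = e ; linked = l ; distinct = u })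
      (λ q → let open IsPath q in starts , ends , linked , distinct)
      (head p Fin.≟ u ×-dec last p Fin.≟ v ×-dec linked? adj? p
        ×-dec allPairs? (λ x y → ¬? (x Fin.≟ y)) p)

    isDistance? : ∀ u v δ → Dec (IsDistance G u v δ)
    isDistance? u v δ = ∃Vec? (suc δ) (isPath? u v) ×-dec map′
      -- Minimality speaks of paths of every length, but only the finitely many lengths below δ can
      -- violate it.
      (λ (none : ∀ {ℓ} → ℓ < δ → _) {ℓ} p path → ≮⇒≥ λ ℓ<δ → none ℓ<δ (p , path))
      (λ least {ℓ} (ℓ<δ : ℓ < δ) (p , path) → <⇒≱ ℓ<δ (least p path))
      (allUpTo? (λ ℓ → ¬? (∃Vec? (suc ℓ) (isPath? u v))) δ)

    isShortestPath? : ∀ {ℓ} (p : Vec (Fin m) (suc ℓ)) → Dec (IsShortestPath G p)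
    isShortestPath? {ℓ} p = Fin.any? λ u → Fin.any? λ v → isPath? u v p ×-dec isDistance? u v ℓ

    isClique? : ∀ k d S → Dec (IsClique G k d S)
    isClique? k d S = map′
      (λ none T T⊆S ∣T∣≡k → decidable-stable (covered? T) λ ¬cov → none (T , T⊆S , ∣T∣≡k , ¬cov))
      refute
      (¬? (anySubset? λ T → T ⊆? S ×-dec ∣ T ∣ ≟ k ×-dec ¬? (covered? T)))
      where
      Covered : Subset m → Set
      Covered T = ∃[ ℓ ] Σ[ p ∈ Vec (Fin m) (suc ℓ) ]
                    IsShortestPath G p × ℓ ≤ d × (∀ {v} → v ∈ₛ T → v ∈ p)

      covered? : ∀ T → Dec (Covered T)
      covered? T = map′
        (λ (ℓ , ℓ<1+d , p , sp , T⊆p) → ℓ , p , sp , s≤s⁻¹ ℓ<1+d , λ {v} → T⊆p v)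
        (λ (ℓ , p , sp , ℓ≤d , T⊆p) → ℓ , s≤s ℓ≤d , p , sp , λ v → T⊆p {v})
        (anyUpTo? (λ ℓ → ∃Vec? (suc ℓ) λ p → isShortestPath? p ×-dec
                     Fin.all? (λ v → v ∈ₛ? T →-dec v ∈ᵥ? p)) (suc d))

      refute : IsClique G k d S → ¬ ∃ λ T → T ⊆ S × ∣ T ∣ ≡ k × ¬ Covered T
      refute clique (T , T⊆S , ∣T∣≡k , ¬cov) = ¬cov (clique T T⊆S ∣T∣≡k)

    -- Tries the lengths d, d - 1, ... in turn. The search ends at the latest with a single vertex,
    -- a shortest path of length 0.
    longest : .{{_ : NonZero m}} → ∀ d → ∃[ ℓ ] Σ[ p ∈ Vec (Fin m) (suc ℓ) ] IsShortestPath G p × ℓ ≤ d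
              × (∀ {ℓ′} (p′ : Vec (Fin m) (suc ℓ′)) → IsShortestPath G p′ → ℓ′ ≤ d → ℓ′ ≤ ℓ)
    longest zero = 0 , v₀ ∷ [] , (v₀ , v₀ , trivial , (_ , trivial) , λ _ _ → z≤n) , z≤n , λ _ _ ℓ′≤0 → ℓ′≤0
      where
      v₀ : Fin m
      v₀ = 0 mod m
      trivial : IsPath G v₀ v₀ (v₀ ∷ [])
      trivial = record { starts = refl ; ends = refl ; linked = [-] ; distinct = [] ∷ [] }
    longest (suc d) with ∃Vec? (suc (suc d)) isShortestPath?
    ... | yes (p , sp) = suc d , p , sp , ≤-refl , λ _ _ ℓ′≤ → ℓ′≤
    ... | no none with ℓ , p , sp , ℓ≤d , max ← longest d =
      ℓ , p , sp , m≤n⇒m≤1+n ℓ≤d , λ p′ sp′ ℓ′≤1+d → max p′ sp′ (shorter p′ sp′ ℓ′≤1+d)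
      where
      shorter : ∀ {ℓ′} (p′ : Vec (Fin m) (suc ℓ′)) → IsShortestPath G p′ → ℓ′ ≤ suc d → ℓ′ ≤ d
      shorter p′ sp′ ℓ′≤1+d with m≤n⇒m<n∨m≡n ℓ′≤1+d
      ... | inj₁ ℓ′<1+d = s≤s⁻¹ ℓ′<1+d
      ... | inj₂ refl = contradiction (p′ , sp′) none

    -- Every clique has at most 2 χ elements, and the vertices of a longest path
    -- already form one with at least 2 χ - 1.
    χ≡⌈ω/2⌉ : ∀ {d ℓ} {p : Vec (Fin m) (suc ℓ)} → IsShortestPath G p → ℓ ≤ d →
              Colourable G 3 d ((suc ℓ + 1) / 2) →
              ∃[ χ ] ∃[ ω ] IsChromaticNumber G 3 d χ × IsCliqueNumber G 3 d ω × χ ≡ (ω + 1) / 2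
    χ≡⌈ω/2⌉ {d} {ℓ} {p} sp@(_ , _ , path , _) ℓ≤d col =
      c , finish (anySubset? λ S → isClique? 3 d S ×-dec ∣ S ∣ ≟ c * 2)
      where
      c = (suc ℓ + 1) / 2
      c>0 : 0 < c
      c>0 = m≥n⇒m/n>0 {suc ℓ + 1} {2} (s≤s (m≤n+m 1 ℓ))
      chromatic : IsChromaticNumber G 3 d c
      chromatic = c>0 , col , λ c′ _ col′ → ⌈/2⌉≤ (length≤2χ col′ sp ℓ≤d)
      Goal = ∃[ ω ] IsChromaticNumber G 3 d c × IsCliqueNumber G 3 d ω × c ≡ (ω + 1) / 2
      finish : Dec (∃ λ S → IsClique G 3 d S × ∣ S ∣ ≡ c * 2) → Goal
      finish (yes big) = c * 2 , chromatic , (big , λ S → clique≤2χ col) ,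
        ≤-antisym (*-cancelʳ-≤ _ _ 2 (≤⌈/2⌉*2 (c * 2))) (⌈/2⌉≤ ≤-refl)
      -- Without a clique of size 2c all cliques have at most 2c - 1 ≤ ℓ + 1 elements, and the
      -- vertices of `p` attain ℓ + 1.
      finish (no none) = suc ℓ , chromatic ,
        ((fromVec p , path-clique sp ℓ≤d , ∣fromVec∣ (IsPath.distinct path)) , upper) , refl
        where
        upper : ∀ S → IsClique G 3 d S → ∣ S ∣ ≤ suc ℓ
        upper S clique = s≤s⁻¹ (begin
          suc ∣ S ∣   ≤⟨ ≤∧≢⇒< (clique≤2χ col clique) (λ eq → none (S , clique , eq)) ⟩
          c * 2       ≤⟨ m/n*n≤m (suc ℓ + 1) 2 ⟩
          suc ℓ + 1   ≡⟨ +-comm (suc ℓ) 1 ⟩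
          suc (suc ℓ) ∎)
          where open ≤-Reasoning

-- Paths along a successor relation

module _ {A : Set} where

  data Steps (R : Rel A 0ℓ) : ℕ → A → A → Set where
    []  : ∀ {u} → Steps R 0 u u
    _∷_ : ∀ {t u v w} → R u v → Steps R t v w → Steps R (suc t) u w

  module _ {R : Rel A 0ℓ} where

    snoc : ∀ {t u v w} → Steps R t u v → R v w → Steps R (suc t) u w
    snoc []       r = r ∷ []
    snoc (s ∷ ss) r = s ∷ snoc ss r

    reverse : ∀ {t u v} → Steps (flip R) t u v → Steps R t v u
    reverse []       = []
    reverse (s ∷ ss) = snoc (reverse ss) s

    walk : ∀ {ℓ} {p : Vec A (suc ℓ)} → Linked R p → Steps R ℓ (head p) (last p)
    walk [-] = []
    walk {p = _ ∷ _ ∷ _} (r ∷ rs) = r ∷ walk rs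

    from-head : ∀ {ℓ x} {p : Vec A (suc ℓ)} → Linked R p → x ∈ p → ∃[ t ] t ≤ ℓ × Steps R t (head p) x
    from-head _ (Any.here refl) = 0 , z≤n , []
    from-head {p = _ ∷ _ ∷ _} (r ∷ rs) (Any.there x∈)
      with t , t≤ , ss ← from-head rs x∈ = suc t , s≤s t≤ , r ∷ ss

    to-last : ∀ {ℓ x} {p : Vec A (suc ℓ)} → Linked R p → x ∈ p → ∃[ t ] t ≤ ℓ × Steps R t x (last p)
    to-last {ℓ} rs (Any.here refl) = ℓ , ≤-refl , walk rs
    to-last {p = _ ∷ _ ∷ _} (r ∷ rs) (Any.there x∈)
      with t , t≤ , ss ← to-last rs x∈ = t , m≤n⇒m≤1+n t≤ , ss

    module _ {P : Pred A 0ℓ} (P? : Decidable P) where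

      -- Advances to the first vertex satisfying `P`. The account `t + ℓ′ ≤ ℓ` of edges used and
      -- edges left lets `triple` iterate this three times.
      pick : ∀ {k ℓ} {p : Vec A (suc ℓ)} → Linked R p → suc k ≤ count P? p →
             ∃[ t ] ∃[ y ] ∃[ ℓ′ ] Σ[ q ∈ Vec A ℓ′ ]
               P y × Steps R t (head p) y × Linked R (y ∷ q) × k ≤ count P? q × t + ℓ′ ≤ ℓ
      pick {p = x ∷ q} rs k< with P? x
      pick {p = x ∷ q} rs k< | yes px = 0 , x , _ , q , px , [] , rs , s≤s⁻¹ k< , ≤-refl
      pick {p = x ∷ _ ∷ _} (r ∷ rs) k< | no _
        with t , y , ℓ′ , q , py , ss , rs′ , k≤ , t+ℓ′≤ ← pick rs k< =
        suc t , y , ℓ′ , q , py , r ∷ ss , rs′ , k≤ , s≤s t+ℓ′≤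

      Triple : ℕ → Set
      Triple ℓ = ∃[ x ] ∃[ y ] ∃[ z ] ∃[ s ] ∃[ t ] P x × P y × P z
                 × Steps R (suc s) x y × Steps R (suc t) y z × suc s + suc t ≤ ℓ

      triple : ∀ {ℓ} {p : Vec A (suc ℓ)} → Linked R p → 3 ≤ count P? p → Triple ℓ
      triple {ℓ} rs 3≤ with pick rs 3≤
      -- The rest still contains vertices satisfying `P`, so it is nonempty; its first edge makes
      -- the number of steps to the next pick positive.
      ... | r , x , suc _ , _ ∷ _ , px , _ , e ∷ rs₁ , 2≤ , r+≤ with pick rs₁ 2≤
      ... | s , y , suc ℓ′ , _ ∷ _ , py , ss , e′ ∷ rs₂ , 1≤ , s+≤ with pick rs₂ 1≤
      ... | t , z , _ , _ , pz , ts , _ , _ , t+≤ =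
        x , y , z , s , t , px , py , pz , e ∷ ss , e′ ∷ ts , (begin
          suc (s + suc t)   ≤⟨ s≤s (+-monoʳ-≤ s (s≤s (m+n≤o⇒m≤o t t+≤))) ⟩
          suc (s + suc ℓ′)  ≤⟨ s≤s s+≤ ⟩
          _                 ≤⟨ m+n≤o⇒n≤o r r+≤ ⟩
          ℓ                 ∎)
        where open ≤-Reasoning

  -- As `N` is functional and injective, a path that changed direction would return at once to the
  -- vertex it came from, against distinctness.
  orient : {N : Rel A 0ℓ} →
           (∀ {x y z} → N x y → N x z → y ≡ z) → (∀ {x y z} → N x z → N y z → x ≡ y) →
           ∀ {ℓ} {p : Vec A (suc ℓ)} → Linked (λ u v → N u v ⊎ N v u) p → Unique p →
           Linked N p ⊎ Linked (flip N) p
  orient fun inj [-] _ = inj₁ [-]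
  orient fun inj (inj₁ e ∷ [-]) _ = inj₁ (e ∷ [-])
  orient fun inj (inj₂ e ∷ [-]) _ = inj₂ (e ∷ [-])
  orient fun inj {p = _ ∷ _ ∷ _ ∷ _} (e ∷ es@(_ ∷ _)) ((_ ∷ x≢z ∷ _) ∷ ds) with e | orient fun inj es ds
  ... | inj₁ xy | inj₁ ys         = inj₁ (xy ∷ ys)
  ... | inj₂ yx | inj₂ ys         = inj₂ (yx ∷ ys)
  ... | inj₁ xy | inj₂ (zy ∷ _)   = contradiction (inj xy zy) x≢z
  ... | inj₂ yx | inj₁ (yz ∷ _)   = contradiction (fun yx yz) x≢z

  orient-triple : {N : Rel A 0ℓ} {P : Pred A 0ℓ} (P? : Decidable P) →
    ∀ {ℓ} {p : Vec A (suc ℓ)} → Linked N p ⊎ Linked (flip N) p → 3 ≤ count P? p → Triple {R = N} P? ℓ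
  orient-triple P? (inj₁ rs) 3≤ = triple P? rs 3≤
  orient-triple P? (inj₂ rs) 3≤ with x , y , z , s , t , px , py , pz , ss , ts , s+t≤ ← triple P? rs 3≤ =
    z , y , x , t , s , pz , py , px , reverse ts , reverse ss
    , ≤-trans (≤-reflexive (+-comm (suc t) (suc s))) s+t≤

  -- The base is the first or the last vertex of the path, according to its orientation. It becomes
  -- the start of the window in `three-in-window`.
  orient-base : {N : Rel A 0ℓ} → ∀ {ℓ} {p : Vec A (suc ℓ)} → Linked N p ⊎ Linked (flip N) p →
                ∃[ b ] (∀ {x} → x ∈ p → ∃[ t ] t ≤ ℓ × Steps N t b x)
  orient-base (inj₁ rs) = _ , from-head rs
  orient-base (inj₂ rs) = _ , λ x∈ → map₂ (map₂ reverse) (to-last rs x∈)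

-- Congruences modulo n

module _ (n : ℕ) .{{_ : NonZero n}} where

  %-congʳ-+ : ∀ x y k → x % n ≡ y % n → (x + k) % n ≡ (y + k) % n
  %-congʳ-+ x y k eq = begin
    (x + k) % n           ≡⟨ %-distribˡ-+ x k n ⟩
    (x % n + k % n) % n   ≡⟨ cong (λ z → (z + k % n) % n) eq ⟩
    (y % n + k % n) % n   ≡⟨ %-distribˡ-+ y k n ⟨
    (y + k) % n           ∎
    where open ≡-Reasoning

  -- a + (n - 1) a is a multiple of n
  %-cancelˡ : ∀ a i j → (a + i) % n ≡ (a + j) % n → i % n ≡ j % n
  %-cancelˡ a i j eq = trans (sym (step i)) (trans (%-congʳ-+ (a + i) (a + j) (pred n * a) eq) (step j))
    where
    step : ∀ i → (a + i + pred n * a) % n ≡ i % n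
    step i = trans (cong (_% n) lem) ([m+kn]%n≡m%n i a n)
      where
      open ≡-Reasoning
      lem : a + i + pred n * a ≡ i + a * n
      lem = begin
        a + i + pred n * a     ≡⟨ cong (_+ pred n * a) (+-comm a i) ⟩
        i + a + pred n * a     ≡⟨ +-assoc i a _ ⟩
        i + (suc (pred n) * a) ≡⟨ cong (λ k → i + k * a) (suc-pred n) ⟩
        i + n * a              ≡⟨ cong (i +_) (*-comm n a) ⟩
        i + a * n              ∎

  %-cancelˡ-< : ∀ a {i j} → i < n → j < n → (a + i) % n ≡ (a + j) % n → i ≡ j
  %-cancelˡ-< a {i} {j} i<n j<n eq = trans (sym (m<n⇒m%n≡m i<n)) (trans (%-cancelˡ a i j eq) (m<n⇒m%n≡m j<n))

  -- The difference y - x is a positive multiple of n.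
  %≡⇒+≤ : ∀ {x y} → x < y → x % n ≡ y % n → x + n ≤ y
  %≡⇒+≤ {x} {y} x<y eq = subst (x + n ≤_) x+e≡y (+-monoʳ-≤ x n≤e)
    where
    e = y ∸ x
    x+e≡y = m+[n∸m]≡n (<⇒≤ x<y)
    instance
      e≢0 : NonZero e
      e≢0 = >-nonZero (m<n⇒0<n∸m x<y)
    e≡0 : e % n ≡ 0 % n
    e≡0 = %-cancelˡ x e 0 (begin
      (x + e) % n   ≡⟨ cong (_% n) x+e≡y ⟩
      y % n         ≡⟨ eq ⟨
      x % n         ≡⟨ cong (_% n) (+-identityʳ x) ⟨
      (x + 0) % n   ∎)
      where open ≡-Reasoning
    n≤e : n ≤ e
    n≤e = ∣⇒≤ (m%n≡0⇒n∣m e n (trans e≡0 (m<n⇒m%n≡m (>-nonZero⁻¹ n))))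

  -- Applied with the number of colours as modulus: three increasing labels of one colour spread
  -- over at least twice that number.
  %≡⇒+2≤ : ∀ {x y z} → x < y → y < z → x % n ≡ y % n → y % n ≡ z % n → x + n * 2 ≤ z
  %≡⇒+2≤ {x} {y} {z} x<y y<z x≡y y≡z = begin
    x + n * 2     ≡⟨ cong (x +_) (*-comm n 2) ⟩
    x + (n + (n + 0)) ≡⟨ cong (λ k → x + (n + k)) (+-identityʳ n) ⟩
    x + (n + n)   ≡⟨ +-assoc x n n ⟨
    x + n + n     ≤⟨ +-monoˡ-≤ n (%≡⇒+≤ x<y x≡y) ⟩
    y + n         ≤⟨ %≡⇒+≤ y<z y≡z ⟩
    z             ∎
    where open ≤-Reasoning

-- Induced subgraphs of a cycle

module Arcs {m n : ℕ} (3≤n : 3 ≤ n) (f : Fin m ↣ Fin n) where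

  instance
    n≢0 : NonZero n
    n≢0 = >-nonZero (≤-trans (s≤s z≤n) 3≤n)

  open Injection f using (to; injective)

  H : Graph m
  H = induced (cycle n 3≤n) f

  pos : Fin m → ℕ
  pos v = toℕ (to v)

  pos<n : ∀ v → pos v < n
  pos<n v = Fin.toℕ<n (to v)

  pos-injective : ∀ {u v} → pos u ≡ pos v → u ≡ v
  pos-injective = injective ∘ Fin.toℕ-injective

  pos% : ∀ v → pos v % n ≡ pos v
  pos% v = m<n⇒m%n≡m (pos<n v)

  Next : Rel (Fin m) 0ℓ
  Next u v = suc (pos u) % n ≡ pos v

  adj? : B.Decidable (Graph.Adj H)
  adj? u v = (suc (pos u) % n ≟ pos v) ⊎-dec (suc (pos v) % n ≟ pos u)

  path-oriented : ∀ {ℓ u v} {p : Vec (Fin m) (suc ℓ)} → IsPath H u v p → Linked Next p ⊎ Linked (flip Next) p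
  path-oriented path = orient
    (λ xy xz → pos-injective (trans (sym xy) xz))
    (λ {x} {y} xz yz → pos-injective (%-cancelˡ-< n 1 (pos<n x) (pos<n y) (trans xz (sym yz))))
    (IsPath.linked path) (IsPath.distinct path)

  Steps⇒pos : ∀ {t u v} → Steps Next t u v → pos v ≡ (pos u + t) % n
  Steps⇒pos {u = u} [] = sym (trans (cong (_% n) (+-identityʳ _)) (pos% u))
  Steps⇒pos {suc t} {u} {w} (_∷_ {v = v} e ss) = begin
    pos w                       ≡⟨ Steps⇒pos ss ⟩
    (pos v + t) % n             ≡⟨ %-congʳ-+ n (pos v) (suc (pos u)) t (trans (pos% v) (sym e)) ⟩
    (suc (pos u) + t) % n       ≡⟨ cong (_% n) (+-suc (pos u) t) ⟨
    (pos u + suc t) % n         ∎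
    where open ≡-Reasoning

  -- φ labels the vertices before reduction modulo the number of colours.
  colourable : ∀ {d L} c .{{_ : NonZero c}} (φ : Fin m → ℕ) →
    (∀ {ℓ} (p : Vec (Fin m) (suc ℓ)) → IsShortestPath H p → ℓ ≤ d → ℓ ≤ L) →
    (∀ {x y z s t} → Steps Next (suc s) x y → Steps Next (suc t) y z → suc s + suc t ≤ L →
      φ x % c ≡ φ y % c → φ y % c ≡ φ z % c → ⊥) →
    Colourable H 3 d c
  colourable {d} {L} c φ short apart = colour , λ i p sp ℓ≤d → ≰⇒> λ 3≤ →
    let x , y , z , s , t , cx , cy , cz , ss , ts , s+t≤ =
          orient-triple _ (path-oriented (sp .proj₂ .proj₂ .proj₁)) 3≤
    in apart ss ts (≤-trans s+t≤ (short p sp ℓ≤d)) (residue cx cy) (residue cy cz)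
    where
    colour : Fin m → Fin c
    colour v = φ v mod c
    residue : ∀ {i u v} → u ∈ₛ colourClass H colour i → v ∈ₛ colourClass H colour i → φ u % c ≡ φ v % c
    residue {i} {u} {v} u∈ v∈ = Fin.fromℕ<-injective _ _ (m%n<n (φ u) c) (m%n<n (φ v) c)
      (trans (∈-colourClass⁻ H colour u∈) (sym (∈-colourClass⁻ H colour v∈)))

  module Proper (q : Fin n) (q∉ : ∀ v → to v ≢ q) where

    e : ℕ
    e = n ∸ suc (toℕ q)

    -- The position counted from the successor of the missing `q`; `q` itself would get n - 1.
    rank : Fin m → ℕ
    rank v = (pos v + e) % n

    -- Only from rank n - 1 would a step wrap around, and that rank belongs to the missing `q`.
    rank-suc : ∀ {u v} → Next u v → rank v ≡ suc (rank u)
    rank-suc {u} {v} next = trans rank≡ (m<n⇒m%n≡m (≤∧≢⇒< (m%n<n _ n) not-last))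
      where
      open ≡-Reasoning
      rank≡ : rank v ≡ suc (rank u) % n
      rank≡ = begin
        (pos v + e) % n         ≡⟨ %-congʳ-+ n (pos v) (suc (pos u)) e (trans (pos% v) (sym next)) ⟩
        suc (pos u + e) % n     ≡⟨ cong (_% n) (+-comm 1 (pos u + e)) ⟩
        (pos u + e + 1) % n     ≡⟨ %-congʳ-+ n (rank u) (pos u + e) 1 (m%n%n≡m%n (pos u + e) n) ⟨
        (rank u + 1) % n        ≡⟨ cong (_% n) (+-comm (rank u) 1) ⟩
        suc (rank u) % n        ∎
      not-last : suc (rank u) ≢ n
      not-last eq = q∉ u (Fin.toℕ-injective (%-cancelˡ-< n e (pos<n u) (Fin.toℕ<n q) (begin
        (e + pos u) % n   ≡⟨ cong (_% n) (+-comm e (pos u)) ⟩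
        rank u            ≡⟨ m<n⇒m%n≡m (m%n<n (pos u + e) n) ⟨
        rank u % n        ≡⟨ cong (_% n) (suc-injective (trans eq (sym (trans (+-comm 1 _) q+e)))) ⟩
        (e + toℕ q) % n   ∎)))
        where
        q+e : e + toℕ q + 1 ≡ n
        q+e = begin
          e + toℕ q + 1     ≡⟨ +-assoc e (toℕ q) 1 ⟩
          e + (toℕ q + 1)   ≡⟨ cong (e +_) (+-comm (toℕ q) 1) ⟩
          e + suc (toℕ q)   ≡⟨ m∸n+n≡m (Fin.toℕ<n q) ⟩
          n                 ∎

    Steps⇒rank : ∀ {t u v} → Steps Next t u v → rank v ≡ rank u + t
    Steps⇒rank [] = sym (+-identityʳ _)
    Steps⇒rank {suc t} {u} (r ∷ rs) =
      trans (Steps⇒rank rs) (trans (cong (_+ t) (rank-suc r)) (sym (+-suc (rank u) t)))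

    -- Ranks grow by one with each step, so three vertices on a path with equal rank modulo c = ⌈(ℓ
    -- + 1) / 2⌉ would span 2c ≥ ℓ + 1 steps, more than the maximal length ℓ.
    χ≡⌈ω/2⌉-proper : .{{_ : NonZero m}} → ∀ d →
      ∃[ χ ] ∃[ ω ] IsChromaticNumber H 3 d χ × IsCliqueNumber H 3 d ω × χ ≡ (ω + 1) / 2
    χ≡⌈ω/2⌉-proper d with ℓ , p , sp , ℓ≤d , max ← Decide.longest H adj? d =
      Decide.χ≡⌈ω/2⌉ H adj? sp ℓ≤d (colourable ((suc ℓ + 1) / 2) {{c≢0 ℓ}} rank max apart)
      where
      c≢0 : ∀ ℓ → NonZero ((suc ℓ + 1) / 2)
      c≢0 ℓ = >-nonZero (m≥n⇒m/n>0 {suc ℓ + 1} {2} (s≤s (m≤n+m 1 ℓ)))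
      apart : ∀ {x y z s t ℓ} → Steps Next (suc s) x y → Steps Next (suc t) y z → suc s + suc t ≤ ℓ →
        let c = (suc ℓ + 1) / 2 ; instance _ = c≢0 ℓ in
        rank x % c ≡ rank y % c → rank y % c ≡ rank z % c → ⊥
      apart {x} {y} {z} {s} {t} {ℓ} ss ts s+t≤ x≡y y≡z =
        <⇒≱ (s≤s s+t≤) (≤-trans (≤⌈/2⌉*2 (suc ℓ)) (+-cancelˡ-≤ (rank x) _ _ (begin
         rank x + c * 2             ≤⟨ %≡⇒+2≤ c {{c≢0 ℓ}} (incr ss) (incr ts) x≡y y≡z ⟩
         rank z                     ≡⟨ Steps⇒rank ts ⟩
         rank y + suc t             ≡⟨ cong (_+ suc t) (Steps⇒rank ss) ⟩
         rank x + suc s + suc t     ≡⟨ +-assoc (rank x) (suc s) (suc t) ⟩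
         rank x + (suc s + suc t)   ∎)))
        where
        open ≤-Reasoning
        c = (suc ℓ + 1) / 2
        incr : ∀ {u v t} → Steps Next (suc t) u v → rank u < rank v
        incr {u} {t = t} ss = subst (rank u <_) (sym (Steps⇒rank ss)) (m<m+n (rank u) (s≤s z≤n))

-- Minima, tabulated paths, cyclic sums and windows of residues

argmin : ∀ {m} {P : Pred (Fin m) 0ℓ} → Decidable P → (g : Fin m → ℕ) → ∃ P →
        ∃[ v ] P v × (∀ {u} → P u → g v ≤ g u)
argmin {P = P} P? g (v , pv) = go v pv (<-wellFounded (g v))
  where
  go : ∀ v → P v → Acc _<_ (g v) → ∃[ v ] P v × (∀ {u} → P u → g v ≤ g u)
  go v pv (acc rec) with Fin.any? (λ u → P? u ×-dec g u <? g v)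
  ... | yes (u , pu , u<v) = go u pu (rec u<v)
  ... | no none = v , pv , λ {u} pu → ≮⇒≥ λ u<v → none (u , pu , u<v)

linked-tabulate : ∀ {A : Set} {R : Rel A 0ℓ} (h : ℕ → A) t →
                  (∀ j → j < t → R (h j) (h (suc j))) → Linked R (tabulate {n = suc t} (h ∘ toℕ))
linked-tabulate h zero    r = [-]
linked-tabulate h (suc t) r = r 0 z<s ∷ linked-tabulate (h ∘ suc) t (λ j j<t → r (suc j) (s<s j<t))

last-tabulate : ∀ {A : Set} (h : ℕ → A) t → last (tabulate {n = suc t} (h ∘ toℕ)) ≡ h t
last-tabulate h zero    = refl
last-tabulate h (suc t) = last-tabulate (h ∘ suc) t

sum-shift : ∀ (φ : ℕ → ℕ) n → sum {n} (λ i → φ (suc (toℕ i))) + φ 0 ≡ sum {n} (φ ∘ toℕ) + φ n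
sum-shift φ zero    = refl
sum-shift φ (suc n) = begin
  φ 1 + S₂ + φ 0          ≡⟨ cong (_+ φ 0) (+-comm (φ 1) S₂) ⟩
  S₂ + φ 1 + φ 0          ≡⟨ cong (_+ φ 0) (sum-shift (φ ∘ suc) n) ⟩
  S₁ + φ (suc n) + φ 0    ≡⟨ +-comm _ (φ 0) ⟩
  φ 0 + (S₁ + φ (suc n))  ≡⟨ +-assoc (φ 0) S₁ _ ⟨
  φ 0 + S₁ + φ (suc n)    ∎
  where
  open ≡-Reasoning
  S₁ = sum {n} (λ i → φ (suc (toℕ i)))
  S₂ = sum {n} (λ i → φ (suc (suc (toℕ i))))

-- A shift by one exchanges the first term for the one n places later, which is equal to it by
-- periodicity.
sum-rotate : ∀ (φ : ℕ → ℕ) n → (∀ k → φ (k + n) ≡ φ k) → ∀ j →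
             sum {n} (λ a → φ (toℕ a + j)) ≡ sum {n} (φ ∘ toℕ)
sum-rotate φ n per zero    = sum-cong-≗ {n} λ a → cong φ (+-identityʳ (toℕ a))
sum-rotate φ n per (suc j) = trans (sum-cong-≗ {n} λ a → cong φ (+-suc (toℕ a) j))
  (trans (+-cancelʳ-≡ (φ j) _ _ (trans (sum-shift (λ k → φ (k + j)) n)
            (cong (sum {n} (λ a → φ (toℕ a + j)) +_) (trans (cong φ (+-comm n j)) (per j)))))
         (sum-rotate φ n per j))

-- A window of three residues that starts at B and covers at most D + 1 places
-- meets the linear order x < y < z in one of three ways, according to which of
-- the three gaps it avoids.
three-in-window : ∀ {n D} .{{_ : NonZero n}} → D < n → ∀ {B i j k x y z} → B < n → i ≤ D → j ≤ D → k ≤ D →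
  x ≡ (B + i) % n → y ≡ (B + j) % n → z ≡ (B + k) % n → x < y → y < z →
  z ≤ x + D ⊎ y + n ≤ z + D ⊎ x + n ≤ y + D
three-in-window {n} {D} D<n {B} {i} {j} {k} {x} {y} {z} B<n i≤D j≤D k≤D x≡ y≡ z≡ x<y y<z
  with unwrap i≤D x≡ | unwrap j≤D y≡ | unwrap k≤D z≡
  where
  -- Since B + i < 2n, reduction modulo n subtracts n at most once.
  unwrap : ∀ {i x} → i ≤ D → x ≡ (B + i) % n → x ≡ B + i ⊎ x + n ≡ B + i
  unwrap {i} {x} i≤D refl with B + i <? n
  ... | yes B+i<n = inj₁ (m<n⇒m%n≡m B+i<n)
  ... | no  B+i≮n = inj₂ (trans (cong (_+ n) (trans (sym (m≤n⇒[n∸m]%m≡n%m (≮⇒≥ B+i≮n)))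
                      (m<n⇒m%n≡m (m<n+o⇒m∸n<o _ n (+-mono-< B<n (≤-<-trans i≤D D<n))))))
                      (m∸n+n≡m (≮⇒≥ B+i≮n)))
... | inj₁ refl | _ | inj₁ refl = inj₁ (+-mono-≤ (m≤m+n B i) k≤D)
... | inj₁ refl | _ | inj₂ z+n≡ = contradiction (<-trans x<y y<z) (≤⇒≯ (+-cancelʳ-≤ n z _ (begin
    z + n       ≡⟨ z+n≡ ⟩
    B + k       ≤⟨ +-mono-≤ (m≤m+n B i) (≤-trans k≤D (<⇒≤ D<n)) ⟩
    B + i + n   ∎)))
  where open ≤-Reasoning
... | inj₂ x+n≡ | inj₁ refl | _ = inj₂ (inj₂ (begin
    x + n       ≡⟨ x+n≡ ⟩
    B + i       ≤⟨ +-mono-≤ (m≤m+n B j) i≤D ⟩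
    B + j + D   ∎))
  where open ≤-Reasoning
... | inj₂ x+n≡ | inj₂ y+n≡ | inj₁ refl = inj₂ (inj₁ (begin
    y + n       ≡⟨ y+n≡ ⟩
    B + j       ≤⟨ +-mono-≤ (m≤m+n B k) j≤D ⟩
    B + k + D   ∎))
  where open ≤-Reasoning
... | inj₂ x+n≡ | inj₂ y+n≡ | inj₂ z+n≡ = inj₁ (+-cancelʳ-≤ n z _ (begin
    z + n           ≡⟨ z+n≡ ⟩
    B + k           ≤⟨ +-mono-≤ (m≤m+n B i) k≤D ⟩
    B + i + D       ≡⟨ cong (_+ D) x+n≡ ⟨
    x + n + D       ≡⟨ +-assoc x n D ⟩
    x + (n + D)     ≡⟨ cong (x +_) (+-comm n D) ⟩
    x + (D + n)     ≡⟨ +-assoc x D n ⟨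
    x + D + n       ∎))
  where open ≤-Reasoning

-- The labels of the colouring of a whole cycle

module Beatty (n c D : ℕ) .{{_ : NonZero n}} .{{_ : NonZero c}} (D<2c : D < c * 2)
              (n≤cQ : n ≤ c * (n * 2 / suc D)) where
  open ≤-Reasoning

  Q K e : ℕ
  Q = n * 2 / suc D
  K = c * Q
  e = pred (c * 2)

  1+e≡2c : suc e ≡ c * 2
  1+e≡2c = suc-pred (c * 2) {{m*n≢0 c 2}}

  -- With e = 2c - 1, D ≤ e gives D (e + 1) ≤ e (D + 1), and (D + 1) Q ≤ 2n by the choice of Q. The
  -- inequality is doubled to make these apply.
  DK≤en : D * K ≤ e * n
  DK≤en = *-cancelʳ-≤ _ _ 2 (begin
    D * (c * Q) * 2     ≡⟨ lem D c Q ⟩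
    D * (c * 2) * Q     ≡⟨ cong (λ k → D * k * Q) 1+e≡2c ⟨
    D * suc e * Q       ≤⟨ *-monoˡ-≤ Q (begin
      D * suc e   ≡⟨ *-suc D e ⟩
      D + D * e   ≤⟨ +-monoˡ-≤ (D * e) (s≤s⁻¹ (≤-trans D<2c (≤-reflexive (sym 1+e≡2c)))) ⟩
      e + D * e   ≡⟨ cong (e +_) (*-comm D e) ⟩
      e + e * D   ≡⟨ *-suc e D ⟨
      e * suc D   ∎) ⟩
    e * suc D * Q       ≡⟨ *-assoc e (suc D) Q ⟩
    e * (suc D * Q)     ≡⟨ cong (e *_) (*-comm (suc D) Q) ⟩
    e * (Q * suc D)     ≤⟨ *-monoʳ-≤ e (m/n*n≤m (n * 2) (suc D)) ⟩
    e * (n * 2)         ≡⟨ *-assoc e n 2 ⟨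
    e * n * 2           ∎)
    where
    lem : ∀ D c Q → D * (c * Q) * 2 ≡ D * (c * 2) * Q
    lem = solve-∀

  beatty : ℕ → ℕ
  beatty i = i * K / n

  +kn : ∀ x k → (x + k * n) / n ≡ x / n + k
  +kn x k = trans (+-distrib-/-∣ʳ x (n∣m*n k)) (cong (x / n +_) (m*n/n≡m k n))

  -- Adding n to i raises the label by K = cQ, a multiple of c, so the colour depends on i modulo n
  -- only.
  beatty-% : ∀ i → beatty (i % n) % c ≡ beatty i % c
  beatty-% i = begin-equality
    beatty (i % n) % c                          ≡⟨ [m+kn]%n≡m%n _ (i / n * Q) c ⟨
    (beatty (i % n) + i / n * Q * c) % c        ≡⟨ cong (λ k → (beatty (i % n) + k) % c) (lem₁ (i / n) Q c) ⟩
    (beatty (i % n) + i / n * K) % c            ≡⟨ cong (_% c) (+kn (i % n * K) (i / n * K)) ⟨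
    (i % n * K + i / n * K * n) / n % c         ≡⟨ cong (λ k → k / n % c) (lem₂ (i % n) (i / n) K n) ⟩
    (i % n + i / n * n) * K / n % c             ≡⟨ cong (λ k → k * K / n % c) (m≡m%n+[m/n]*n i n) ⟨
    beatty i % c                                ∎
    where
    lem₁ : ∀ q Q c → q * Q * c ≡ q * (c * Q)
    lem₁ = solve-∀
    lem₂ : ∀ r q K n → r * K + q * K * n ≡ (r + q * n) * K
    lem₂ = solve-∀

  beatty-< : ∀ i t → beatty i < beatty (i + suc t)
  beatty-< i t = begin
    suc (beatty i)              ≡⟨ +-comm 1 (beatty i) ⟩
    beatty i + 1                ≡⟨ +kn (i * K) 1 ⟨
    (i * K + 1 * n) / n         ≤⟨ /-monoˡ-≤ n (begin
      i * K + 1 * n       ≡⟨ cong (i * K +_) (*-identityˡ n) ⟩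
      i * K + n           ≤⟨ +-monoʳ-≤ (i * K) n≤cQ ⟩
      i * K + K           ≤⟨ +-monoʳ-≤ (i * K) (m≤m+n K (t * K)) ⟩
      i * K + suc t * K   ≡⟨ *-distribʳ-+ K i (suc t) ⟨
      (i + suc t) * K     ∎) ⟩
    beatty (i + suc t)          ∎

  beatty-≤ : ∀ i {t} → t ≤ D → beatty (i + t) ≤ beatty i + e
  beatty-≤ i {t} t≤D = begin
    (i + t) * K / n         ≡⟨ /-congˡ (*-distribʳ-+ K i t) ⟩
    (i * K + t * K) / n     ≤⟨ /-monoˡ-≤ n (+-monoʳ-≤ (i * K) (≤-trans (*-monoˡ-≤ K t≤D) DK≤en)) ⟩
    (i * K + e * n) / n     ≡⟨ +kn (i * K) e ⟩
    beatty i + e            ∎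

  -- Three labels of one colour would spread over at least 2c, but D steps raise a label by at most
  -- 2c - 1.
  beatty-apart : ∀ i {s t} → suc s + suc t ≤ D →
    beatty i % c ≡ beatty (i + suc s) % c → beatty (i + suc s) % c ≡ beatty (i + suc s + suc t) % c → ⊥
  beatty-apart i {s} {t} s+t≤D ≡₁ ≡₂ = <-irrefl refl (+-cancelˡ-≤ (beatty i) _ _ (begin
    beatty i + suc e                 ≡⟨ cong (beatty i +_) 1+e≡2c ⟩
    beatty i + c * 2                 ≤⟨ %≡⇒+2≤ c (beatty-< i s) (beatty-< (i + suc s) t) ≡₁ ≡₂ ⟩
    beatty (i + suc s + suc t)       ≡⟨ cong beatty (+-assoc i (suc s) (suc t)) ⟩
    beatty (i + (suc s + suc t))     ≤⟨ beatty-≤ i s+t≤D ⟩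
    beatty i + e                     ∎))

-- Shortest paths and colourings when `f` is onto, so that `H` is the cycle with its vertices
-- renamed

module Full {m n : ℕ} (3≤n : 3 ≤ n) (f : Fin m ↣ Fin n)
            (from : Fin n → Fin m) (to∘from : ∀ k → Injection.to f (from k) ≡ k) (d : ℕ) where

  open Arcs 3≤n f
  open Injection f using (to)

  D : ℕ
  D = d ⊓ (n / 2)

  2D≤n : D + D ≤ n
  2D≤n = begin
    D + D             ≡⟨ cong (D +_) (+-identityʳ D) ⟨
    2 * D             ≡⟨ *-comm 2 D ⟩
    D * 2             ≤⟨ *-monoˡ-≤ 2 (m⊓n≤n d (n / 2)) ⟩
    n / 2 * 2         ≤⟨ m/n*n≤m n 2 ⟩
    n                 ∎
    where open ≤-Reasoning

  D<n : D < n
  D<n = ≰⇒> λ n≤D → <-irrefl refl (begin-strict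
    n       <⟨ m<m+n n (≤-trans (s≤s z≤n) 3≤n) ⟩
    n + n   ≤⟨ +-mono-≤ n≤D n≤D ⟩
    D + D   ≤⟨ 2D≤n ⟩
    n       ∎)
    where open ≤-Reasoning

  -- Vertices are indexed by all naturals with period n, so that arcs may run past position n - 1.
  point : ℕ → Fin m
  point k = from (k mod n)

  pos-point : ∀ k → pos (point k) ≡ k % n
  pos-point k = trans (cong toℕ (to∘from (k mod n))) (Fin.toℕ-fromℕ< (m%n<n k n))

  point-cong : ∀ j k → j % n ≡ k % n → point j ≡ point k
  point-cong j k eq = pos-injective (trans (pos-point j) (trans eq (sym (pos-point k))))

  point-pos : ∀ v → point (pos v) ≡ v
  point-pos v = pos-injective (trans (pos-point (pos v)) (pos% v))

  point-injective : ∀ a {i j} → i < n → j < n → point (a + i) ≡ point (a + j) → i ≡ j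
  point-injective a {i} {j} i<n j<n eq = %-cancelˡ-< n a i<n j<n
    (trans (sym (pos-point (a + i))) (trans (cong pos eq) (pos-point (a + j))))

  Next-point : ∀ k → Next (point k) (point (suc k))
  Next-point k = begin
    suc (pos (point k)) % n     ≡⟨ cong (λ j → suc j % n) (pos-point k) ⟩
    suc (k % n) % n             ≡⟨ cong (_% n) (+-comm 1 (k % n)) ⟩
    (k % n + 1) % n             ≡⟨ %-congʳ-+ n (k % n) k 1 (m%n%n≡m%n k n) ⟩
    (k + 1) % n                 ≡⟨ cong (_% n) (+-comm k 1) ⟩
    suc k % n                   ≡⟨ pos-point (suc k) ⟨
    pos (point (suc k))         ∎
    where open ≡-Reasoning

  -- The same vertices in both directions: minimality of a path only compares it with paths that
  -- have its own start and end.
  arc arcʳ : ℕ → ∀ t → Vec (Fin m) (suc t)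
  arc  a t = tabulate λ j → point (a + toℕ j)
  arcʳ a t = tabulate λ j → point (a + (t ∸ toℕ j))

  arc-isPath : ∀ a t → t < n → IsPath H (point a) (point (a + t)) (arc a t)
  arc-isPath a t t<n = record
    { starts   = cong point (+-identityʳ a)
    ; ends     = last-tabulate (λ j → point (a + j)) t
    ; linked   = linked-tabulate (λ j → point (a + j)) t λ j _ →
        inj₁ (subst (λ k → Next (point (a + j)) (point k)) (sym (+-suc a j)) (Next-point (a + j)))
    ; distinct = Unique.tabulate⁺ λ {i} {j} eq → Fin.toℕ-injective
        (point-injective a (<-≤-trans (Fin.toℕ<n i) t<n) (<-≤-trans (Fin.toℕ<n j) t<n) eq)
    }

  arcʳ-isPath : ∀ a t → t < n → IsPath H (point (a + t)) (point a) (arcʳ a t)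
  arcʳ-isPath a t t<n = record
    { starts   = refl
    ; ends     = trans (last-tabulate (λ j → point (a + (t ∸ j))) t)
                       (cong point (trans (cong (a +_) (n∸n≡0 t)) (+-identityʳ a)))
    ; linked   = linked-tabulate (λ j → point (a + (t ∸ j))) t λ j j<t →
        inj₂ (subst (λ k → Next (point (a + (t ∸ suc j))) (point k))
                    (trans (sym (+-suc a _)) (cong (a +_) (sym (+-∸-assoc 1 j<t))))
                    (Next-point (a + (t ∸ suc j))))
    ; distinct = Unique.tabulate⁺ λ {i} {j} eq → Fin.toℕ-injective
        (∸-cancelˡ-≡ (s≤s⁻¹ (Fin.toℕ<n i)) (s≤s⁻¹ (Fin.toℕ<n j))
          (point-injective a (≤-<-trans (m∸n≤m t (toℕ i)) t<n) (≤-<-trans (m∸n≤m t (toℕ j)) t<n) eq))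
    }

  -- Two vertices ℓ > 0 steps apart are joined by the arc of ℓ % n steps and by
  -- the complementary arc of n - ℓ steps.
  half : ∀ {ℓ} a → 0 < ℓ → (∀ {t} → t < n → point (a + t) ≡ point (a + ℓ) → ℓ ≤ t) →
         (∀ {t} → t < n → point (a + ℓ + t) ≡ point a → ℓ ≤ t) → ℓ + ℓ ≤ n
  half {ℓ} a 0<ℓ arc≥ coarc≥ = begin
    ℓ + ℓ         ≤⟨ +-monoˡ-≤ ℓ (coarc≥ (∸-monoʳ-< 0<ℓ (<⇒≤ ℓ<n)) (point-cong _ a around)) ⟩
    n ∸ ℓ + ℓ     ≡⟨ m∸n+n≡m (<⇒≤ ℓ<n) ⟩
    n             ∎
    where
    open ≤-Reasoning
    ℓ<n : ℓ < n
    ℓ<n = ≤-<-trans (arc≥ (m%n<n ℓ n) (point-cong _ (a + ℓ) (begin-equality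
      (a + ℓ % n) % n     ≡⟨ cong (_% n) (+-comm a (ℓ % n)) ⟩
      (ℓ % n + a) % n     ≡⟨ %-congʳ-+ n (ℓ % n) ℓ a (m%n%n≡m%n ℓ n) ⟩
      (ℓ + a) % n         ≡⟨ cong (_% n) (+-comm ℓ a) ⟩
      (a + ℓ) % n         ∎))) (m%n<n ℓ n)
    around : (a + ℓ + (n ∸ ℓ)) % n ≡ a % n
    around = begin-equality
      (a + ℓ + (n ∸ ℓ)) % n     ≡⟨ cong (_% n) (+-assoc a ℓ (n ∸ ℓ)) ⟩
      (a + (ℓ + (n ∸ ℓ))) % n   ≡⟨ cong (λ k → (a + k) % n) (m+[n∸m]≡n (<⇒≤ ℓ<n)) ⟩
      (a + n) % n               ≡⟨ [m+n]%n≡m%n a n ⟩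
      a % n                     ∎

  walk-end : ∀ {ℓ u v} → Steps Next ℓ u v → v ≡ point (pos u + ℓ)
  walk-end {ℓ} {u} {v} ss = pos-injective (trans (Steps⇒pos ss) (sym (pos-point (pos u + ℓ))))

  recast : ∀ {ℓ u u′ v v′} {p : Vec (Fin m) (suc ℓ)} → u ≡ u′ → v ≡ v′ → IsPath H u v p → IsPath H u′ v′ p
  recast refl refl path = path

  shortest⇒≤n/2 : ∀ {ℓ} {p : Vec (Fin m) (suc ℓ)} → IsShortestPath H p → ℓ + ℓ ≤ n
  shortest⇒≤n/2 {zero} _ = z≤n
  shortest⇒≤n/2 {ℓ@(suc _)} {p} (_ , _ , path@(record { starts = refl ; ends = refl }) , _ , least)
    with path-oriented path
  ... | inj₁ rs = half a z<s
    (λ {t} t<n eq → least (arc a t) (recast (point-pos _)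
      (trans eq (sym (walk-end (walk rs)))) (arc-isPath a t t<n)))
    (λ {t} t<n eq → least (arcʳ (a + ℓ) t) (recast (trans eq (point-pos _))
      (sym (walk-end (walk rs))) (arcʳ-isPath (a + ℓ) t t<n)))
    where a = pos (head p)
  -- A path running backwards is compared with the same two arcs, each traversed the other way.
  ... | inj₂ rs = half a z<s
    (λ {t} t<n eq → least (arcʳ a t) (recast
      (trans eq (sym (walk-end (reverse (walk rs))))) (point-pos _) (arcʳ-isPath a t t<n)))
    (λ {t} t<n eq → least (arc (a + ℓ) t) (recast
      (sym (walk-end (reverse (walk rs)))) (trans eq (point-pos _)) (arc-isPath (a + ℓ) t t<n)))
    where a = pos (last p)

  short : ∀ {ℓ} (p : Vec (Fin m) (suc ℓ)) → IsShortestPath H p → ℓ ≤ d → ℓ ≤ D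
  short {ℓ} p sp ℓ≤d = ⊓-glb ℓ≤d (begin
    ℓ           ≡⟨ m*n/n≡m ℓ 2 ⟨
    ℓ * 2 / 2   ≤⟨ /-monoˡ-≤ 2 (begin
      ℓ * 2         ≡⟨ *-comm ℓ 2 ⟩
      ℓ + (ℓ + 0)   ≡⟨ cong (ℓ +_) (+-identityʳ ℓ) ⟩
      ℓ + ℓ         ≤⟨ shortest⇒≤n/2 sp ⟩
      n             ∎) ⟩
    n / 2       ∎)
    where open ≤-Reasoning

  -- A competing path of length ℓ runs forwards, with ℓ ≡ D modulo n and D < n, or backwards, with D
  -- + ℓ ≡ 0. In the latter case D + ℓ is 0 or at least n ≥ 2D.
  arc-shortest : ∀ a → IsShortestPath H (arc a D)
  arc-shortest a = point a , point (a + D) , arc-isPath a D D<n , (_ , arc-isPath a D D<n) , least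
    where
    open ≤-Reasoning
    least : ∀ {ℓ} (p : Vec (Fin m) (suc ℓ)) → IsPath H (point a) (point (a + D)) p → D ≤ ℓ
    least {ℓ} p path@(record { starts = starts ; ends = ends }) with path-oriented path
    ... | inj₁ rs = begin
      D         ≡⟨ m<n⇒m%n≡m D<n ⟨
      D % n     ≡⟨ %-cancelˡ n a D ℓ (begin-equality
        (a + D) % n                 ≡⟨ pos-point (a + D) ⟨
        pos (point (a + D))         ≡⟨ Steps⇒pos (subst₂ (Steps Next ℓ) starts ends (walk rs)) ⟩
        (pos (point a) + ℓ) % n     ≡⟨ cong (λ k → (k + ℓ) % n) (pos-point a) ⟩
        (a % n + ℓ) % n             ≡⟨ %-congʳ-+ n (a % n) a ℓ (m%n%n≡m%n a n) ⟩
        (a + ℓ) % n                 ∎) ⟩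
      ℓ % n     ≤⟨ m%n≤m ℓ n ⟩
      ℓ         ∎
    ... | inj₂ rs with D + ℓ in eq
    ... | zero  = ≤-trans (≤-reflexive (m+n≡0⇒m≡0 D eq)) z≤n
    ... | suc k = +-cancelˡ-≤ D D ℓ (begin
      D + D     ≤⟨ 2D≤n ⟩
      n         ≤⟨ %≡⇒+≤ n z<s (%-cancelˡ n a 0 (suc k) (begin-equality
        (a + 0) % n                       ≡⟨ cong (_% n) (+-identityʳ a) ⟩
        a % n                             ≡⟨ pos-point a ⟨
        pos (point a)                     ≡⟨ Steps⇒pos (reverse (subst₂ (Steps (flip Next) ℓ) starts ends (walk rs))) ⟩
        (pos (point (a + D)) + ℓ) % n     ≡⟨ cong (λ k → (k + ℓ) % n) (pos-point (a + D)) ⟩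
        ((a + D) % n + ℓ) % n             ≡⟨ %-congʳ-+ n ((a + D) % n) (a + D) ℓ (m%n%n≡m%n (a + D) n) ⟩
        (a + D + ℓ) % n                   ≡⟨ cong (_% n) (+-assoc a D ℓ) ⟩
        (a + (D + ℓ)) % n                 ≡⟨ cong (λ k → (a + k) % n) eq ⟩
        (a + suc k) % n                   ∎)) ⟩
      suc k     ≡⟨ eq ⟨
      D + ℓ     ∎)

  c : ℕ
  c = (suc D + 1) / 2

  room⇒χ≡⌈ω/2⌉ : n ≤ c * (n * 2 / suc D) →
    ∃[ χ ] ∃[ ω ] IsChromaticNumber H 3 d χ × IsCliqueNumber H 3 d ω × χ ≡ (ω + 1) / 2
  room⇒χ≡⌈ω/2⌉ n≤cQ = Decide.χ≡⌈ω/2⌉ H adj? (arc-shortest 0) (m⊓n≤m d (n / 2))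
    (colourable c (beatty ∘ pos) short λ {x} ss ts s+t≤D x≡y y≡z →
      -- The positions of y and z may have wrapped around. They are replaced by `pos x` plus the
      -- steps taken, which preserves the colours.
      let y≡ = beatty-step ss
          z≡ = trans (beatty-step ts) (beatty-shift (Steps⇒pos ss) _)
      in beatty-apart (pos x) s+t≤D (trans x≡y y≡) (trans (sym y≡) (trans y≡z z≡)))
    where
    instance
      c≢0 : NonZero c
      c≢0 = >-nonZero (m≥n⇒m/n>0 {suc D + 1} {2} (s≤s (m≤n+m 1 D)))
    open Beatty n c D (≤⌈/2⌉*2 (suc D)) n≤cQ
    open ≡-Reasoning
    beatty-shift : ∀ {i j} → i ≡ j % n → ∀ t → beatty (i + t) % c ≡ beatty (j + t) % c
    beatty-shift {i} {j} refl t = begin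
      beatty (j % n + t) % c          ≡⟨ beatty-% (j % n + t) ⟨
      beatty ((j % n + t) % n) % c    ≡⟨ cong (λ k → beatty k % c) (%-congʳ-+ n (j % n) j t (m%n%n≡m%n j n)) ⟩
      beatty ((j + t) % n) % c        ≡⟨ beatty-% (j + t) ⟩
      beatty (j + t) % c              ∎
    beatty-step : ∀ {t u v} → Steps Next t u v → beatty (pos v) % c ≡ beatty (pos u + t) % c
    beatty-step {t} {u} ss = trans (cong (λ k → beatty k % c) (Steps⇒pos ss)) (beatty-% (pos u + t))

  -- Double counting of the vertices of one colour in the n windows of D + 1 vertices.
  colourable⇒n≤ : ∀ {χ} → Colourable H 3 d χ → n ≤ χ * (n * 2 / suc D)
  colourable⇒n≤ {χ} (col , indep) = pigeonhole col (tabulate {n = n} (point ∘ toℕ)) bound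
    where
    open ≤-Reasoning
    bound : ∀ i → count (λ v → col v Fin.≟ i) (tabulate {n = n} (point ∘ toℕ)) ≤ n * 2 / suc D
    bound i = begin
      count (λ v → col v Fin.≟ i) (tabulate {n = n} (point ∘ toℕ))  ≡⟨ count-tabulate (λ v → col v Fin.≟ i) {n} (point ∘ toℕ) ⟩
      S                     ≡⟨ m*n/n≡m S (suc D) ⟨
      S * suc D / suc D     ≤⟨ /-monoˡ-≤ (suc D) (begin
        S * suc D                                         ≡⟨ *-comm S (suc D) ⟩
        suc D * S                                         ≡⟨ sum-const (suc D) S ⟨
        -- Rotation by each offset j leaves S unchanged; exchanging the two sums then groups the
        -- terms by windows.
        sum {suc D} (λ _ → S)                             ≡⟨ sum-cong-≗ {suc D} (λ j → sum-rotate φ n periodic (toℕ j)) ⟨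
        sum {suc D} (λ j → sum {n} λ a → φ (toℕ a + toℕ j)) ≡⟨ ∑-comm {suc D} {n} (λ j a → φ (toℕ a + toℕ j)) ⟩
        sum {n} (λ a → sum {suc D} λ j → φ (toℕ a + toℕ j)) ≤⟨ sum≤ {n} _ (window ∘ toℕ) ⟩
        n * 2                                             ∎) ⟩
      n * 2 / suc D         ∎
      where
      φ : ℕ → ℕ
      φ k = 𝟙 (col (point k) Fin.≟ i)
      S = sum {n} (φ ∘ toℕ)
      periodic : ∀ k → φ (k + n) ≡ φ k
      periodic k = cong (λ v → 𝟙 (col v Fin.≟ i)) (point-cong (k + n) k ([m+n]%n≡m%n k n))
      window : ∀ a → sum {suc D} (λ j → φ (a + toℕ j)) ≤ 2
      window a = begin
        sum {suc D} (λ j → φ (a + toℕ j))             ≡⟨ count-tabulate (λ v → col v Fin.≟ i) {suc D} (λ j → point (a + toℕ j)) ⟨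
        count (λ v → col v Fin.≟ i) (arc a D)         ≡⟨ count-colourClass H col i (arc a D) ⟨
        count (_∈ₛ? colourClass H col i) (arc a D)    ≤⟨ s≤s⁻¹ (indep i (arc a D) (arc-shortest a) (m⊓n≤m d (n / 2))) ⟩
        2                                             ∎

-- Cliques of a cycle

mod-injective : ∀ {n x y} .{{_ : NonZero n}} → x < n → y < n → x mod n ≡ y mod n → x ≡ y
mod-injective {n} {x} {y} x<n y<n eq = begin
  x           ≡⟨ m<n⇒m%n≡m x<n ⟨
  x % n       ≡⟨ Fin.fromℕ<-injective _ _ (m%n<n x n) (m%n<n y n) eq ⟩
  y % n       ≡⟨ m<n⇒m%n≡m y<n ⟩
  y           ∎
  where open ≡-Reasoning

-- A clique S seen from its element o: r v is the number of steps from o to v, and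
-- any three elements of S fit into a window of D + 1 places.
module Spread {m n D : ℕ} .{{_ : NonZero n}} (D<n : D < n) (2D≤n : D + D ≤ n)
  (S : Subset m) (o : Fin m) (o∈S : o ∈ₛ S)
  (r : Fin m → ℕ) (r<n : ∀ v → r v < n) (r-origin : r o ≡ 0)
  (r-injective : ∀ {u v} → r u ≡ r v → u ≡ v)
  (triples : ∀ {u v w} → u ∈ₛ S → v ∈ₛ S → w ∈ₛ S → r u < r v → r v < r w →
             r w ≤ r u + D ⊎ r v + n ≤ r w + D ⊎ r u + n ≤ r v + D)
  where

  r> : ∀ {v} → v ≢ o → 0 < r v
  r> {v} v≢o = n≢0⇒n>0 λ r≡0 → v≢o (r-injective (trans r≡0 (sym r-origin)))

  -- Rotation by s is injective and carries S into the residues 0, ..., D.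
  in-window : ∀ s → (∀ {v} → v ∈ₛ S → (r v + s) % n ≤ D) → ∣ S ∣ ≤ suc D
  in-window s bound with xs , uniq , xs∈S ← elements S =
    unique-injection (λ v → (r v + s) % n mod suc D) (_∈ₛ S) uniq xs∈S λ {u} {v} u∈ v∈ eq → r-injective
      (%-cancelˡ-< n s (r<n u) (r<n v)
        (trans (cong (_% n) (+-comm s (r u)))
          (trans (mod-injective (s≤s (bound u∈)) (s≤s (bound v∈)) eq) (cong (_% n) (+-comm (r v) s)))))

  -- A `Near` element does not reach o within D forward steps; a `Far` one is not reached from o
  -- within D forward steps.
  Near Far : Fin m → Set
  Near v = v ∈ₛ S × 0 < r v × r v + D < n
  Far  v = v ∈ₛ S × D < r v

  near? : Decidable Near
  near? v = v ∈ₛ? S ×-dec 0 <? r v ×-dec r v + D <? n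

  far? : Decidable Far
  far? v = v ∈ₛ? S ×-dec D <? r v

  -- Such an x would not fit into one window with the origin o.
  far-near : ∀ {x z} → x ∈ₛ S → D < r x → r x + D < n → z ∈ₛ S → 0 < r z → r z ≢ r x → ⊥
  far-near {x} {z} x∈ D<x x+D<n z∈ 0<z z≢x with <-cmp (r z) (r x)
  ... | tri≈ _ z≡x _ = z≢x z≡x
  ... | tri< z<x _ _ with triples o∈S z∈ x∈ (subst (_< r z) (sym r-origin) 0<z) z<x
  ...   | inj₁ x≤D            = <⇒≱ D<x (subst (λ k → r x ≤ k + D) r-origin x≤D)
  ...   | inj₂ (inj₁ z+n≤x+D) = <⇒≱ x+D<n (≤-trans (m≤n+m n (r z)) z+n≤x+D)
  ...   | inj₂ (inj₂ n≤z+D)   = <⇒≱ (<-trans (+-monoˡ-< D z<x) x+D<n) (subst (λ k → k + n ≤ r z + D) r-origin n≤z+D)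
  far-near {x} {z} x∈ D<x x+D<n z∈ 0<z z≢x | tri> _ _ x<z
    with triples o∈S x∈ z∈ (subst (_< r x) (sym r-origin) (≤-<-trans z≤n D<x)) x<z
  ...   | inj₁ z≤D            = <⇒≱ (<-trans D<x x<z) (subst (λ k → r z ≤ k + D) r-origin z≤D)
  ...   | inj₂ (inj₁ x+n≤z+D) = <⇒≱ (+-mono-< D<x (r<n z)) (≤-trans x+n≤z+D (≤-reflexive (+-comm (r z) D)))
  ...   | inj₂ (inj₂ n≤x+D)   = <⇒≱ x+D<n (subst (λ k → k + n ≤ r x + D) r-origin n≤x+D)

  -- For o, x, y only the window from y past o to x is left. If x came at or after y, one vertex
  -- would be both near and far, against `far-near`; when x = y, `third` supplies the further
  -- element needed there.
  opposite : (∀ y → ∃[ z ] z ∈ₛ S × 0 < r z × r z ≢ r y) → ∀ {x y} → Near x → Far y → r x + n ≤ r y + D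
  opposite third {x} {y} (x∈ , 0<x , x+D<n) (y∈ , D<y) with <-cmp (r x) (r y)
  ... | tri< x<y _ _ with triples o∈S x∈ y∈ (subst (_< r x) (sym r-origin) 0<x) x<y
  ...   | inj₁ y≤D            = contradiction (subst (λ k → r y ≤ k + D) r-origin y≤D) (<⇒≱ D<y)
  ...   | inj₂ (inj₁ goal)    = goal
  ...   | inj₂ (inj₂ n≤x+D)   = contradiction (subst (λ k → k + n ≤ r x + D) r-origin n≤x+D) (<⇒≱ x+D<n)
  opposite third {x} {y} (x∈ , 0<x , x+D<n) (y∈ , D<y) | tri> _ _ y<x =
    ⊥-elim (far-near x∈ (<-trans D<y y<x) x+D<n y∈ (≤-<-trans z≤n D<y) (<⇒≢ y<x))
  opposite third {x} {y} (x∈ , 0<x , x+D<n) (y∈ , D<y) | tri≈ _ x≡y _ with z , z∈ , 0<z , z≢y ← third y =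
    ⊥-elim (far-near y∈ D<y (subst (λ k → k + D < n) x≡y x+D<n) z∈ 0<z z≢y)

  -- Without far elements S lies in the window starting at o, without near ones in the window ending
  -- at o. Otherwise it lies in the window starting at the first far element y, unless some element
  -- is antipodal to o.
  cliqueBound : (∀ y → ∃[ z ] z ∈ₛ S × 0 < r z × r z ≢ r y) → ∀ {B} → suc D ≤ B → 4 ≤ B → ∣ S ∣ ≤ B
  cliqueBound third {B} D<B 4≤B with Fin.any? far? | Fin.any? near?
  ... | no none | _ = ≤-trans (in-window 0 λ {v} v∈ → begin
      (r v + 0) % n   ≤⟨ m%n≤m (r v + 0) n ⟩
      r v + 0         ≡⟨ +-identityʳ (r v) ⟩
      r v             ≤⟨ ≮⇒≥ (λ D<v → none (v , v∈ , D<v)) ⟩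
      D               ∎) D<B
    where open ≤-Reasoning
  ... | yes _ | no none = ≤-trans (in-window D λ {v} v∈ →
          bound (r v) (r<n v) λ 0<v v+D<n → none (v , v∈ , 0<v , v+D<n)) D<B
    where
    open ≤-Reasoning
    bound : ∀ k → k < n → (0 < k → ¬ k + D < n) → (k + D) % n ≤ D
    bound zero        _   _   = m%n≤m D n
    bound k@(suc _) k<n ¬near = begin
      (k + D) % n       ≡⟨ m≤n⇒[n∸m]%m≡n%m (≮⇒≥ (¬near z<s)) ⟨
      (k + D ∸ n) % n   ≤⟨ m%n≤m _ n ⟩
      k + D ∸ n         ≤⟨ ∸-monoˡ-≤ n (+-monoˡ-≤ D (<⇒≤ k<n)) ⟩
      n + D ∸ n         ≡⟨ m+n∸m≡n n D ⟩
      D                 ∎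
  ... | yes far | yes near@(x , x∈ , 0<x , x+D<n)
    with y , (y∈ , D<y) , y-least ← argmin far? r far
       | Fin.any? (λ v → v ∈ₛ? S ×-dec (r v ≟ D ×-dec n ≟ D + D))
  ... | no none = ≤-trans (in-window (n ∸ r y) λ {v} v∈ → bound v v∈) D<B
    where
    open ≤-Reasoning
    shift : ∀ {v} → r v + n ≤ r y + D → r v + (n ∸ r y) ≤ D
    shift {v} le = +-cancelˡ-≤ (r y) _ _ (begin
      r y + (r v + (n ∸ r y))   ≡⟨ +-comm (r y) _ ⟩
      r v + (n ∸ r y) + r y     ≡⟨ +-assoc (r v) _ (r y) ⟩
      r v + ((n ∸ r y) + r y)   ≡⟨ cong (r v +_) (m∸n+n≡m (<⇒≤ (r<n y))) ⟩
      r v + n                   ≤⟨ le ⟩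
      r y + D                   ∎)
    x+n≤y+D = opposite third (near .proj₂) (y∈ , D<y)
    n≤y+D : n ≤ r y + D
    n≤y+D = ≤-trans (m≤n+m n (r x)) x+n≤y+D
    bound : ∀ v → v ∈ₛ S → (r v + (n ∸ r y)) % n ≤ D
    bound v v∈ with D <? r v | 0 <? r v | r v + D <? n
    ... | yes D<v | _ | _ = begin
      (r v + (n ∸ r y)) % n         ≡⟨ cong (_% n) (begin-equality
        r v + (n ∸ r y)             ≡⟨ +-∸-assoc (r v) (<⇒≤ (r<n y)) ⟨
        (r v + n) ∸ r y             ≡⟨ +-∸-comm n (y-least (v∈ , D<v)) ⟩
        r v ∸ r y + n               ∎) ⟩
      (r v ∸ r y + n) % n           ≡⟨ [m+n]%n≡m%n (r v ∸ r y) n ⟩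
      (r v ∸ r y) % n               ≤⟨ m%n≤m _ n ⟩
      r v ∸ r y                     ≤⟨ m≤n+o⇒m∸n≤o (r v) (r y) (≤-trans (<⇒≤ (r<n v)) n≤y+D) ⟩
      D                             ∎
    ... | no _ | no r≯0 | _ = ≤-trans (m%n≤m _ n) (shift {v} (subst (λ k → k + n ≤ r y + D) (sym (n≤0⇒n≡0 (≮⇒≥ r≯0))) n≤y+D))
    ... | no _ | yes 0<v | yes v+D<n = ≤-trans (m%n≤m _ n) (shift (opposite third (v∈ , 0<v , v+D<n) (y∈ , D<y)))
    ... | no D≮v | yes _ | no v+D≮n = contradiction (v , v∈ , v≡D , n≡2D) none
      where
      D≤v : D ≤ r v
      D≤v = +-cancelʳ-≤ D D (r v) (≤-trans 2D≤n (≮⇒≥ v+D≮n))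
      v≡D = ≤-antisym (≮⇒≥ D≮v) D≤v
      n≡2D : n ≡ D + D
      n≡2D = ≤-antisym (subst (λ k → n ≤ k + D) v≡D (≮⇒≥ v+D≮n)) 2D≤n
  -- Here S consists of two antipodal pairs. All of C_4 is such a clique, with D + 1 = 3, whence the
  -- hypothesis 4 ≤ B.
  ... | yes (a , a∈ , a≡D , n≡2D) with xs , uniq , xs∈S ← elements S =
    ≤-trans (length≤count Fin._≟_ {P = λ _ → ⊤} (λ _ → yes tt) {xs = o ∷ x ∷ a ∷ y ∷ []} uniq
              (All.map (λ {v} → four v) xs∈S) (All.universal _ xs)) 4≤B
    where
    open ≤-Reasoning
    -- The triple x, a, y, with a opposite to o, leaves no room for r y > r x + D.
    antipodal : ∀ {x y} → Near x → Far y → r y ≡ r x + D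
    antipodal {x} {y} nx@(x∈ , 0<x , x+D<n) fy@(y∈ , D<y) =
      ≤-antisym upper (+-cancelʳ-≤ D _ _ (begin
        r x + D + D     ≡⟨ +-assoc (r x) D D ⟩
        r x + (D + D)   ≡⟨ cong (r x +_) n≡2D ⟨
        r x + n         ≤⟨ opposite third nx fy ⟩
        r y + D         ∎))
      where
      upper : r y ≤ r x + D
      upper with triples x∈ a∈ y∈
                   (subst (r x <_) (sym a≡D) (+-cancelʳ-< D _ _ (subst (r x + D <_) n≡2D x+D<n)))
                   (subst (_< r y) (sym a≡D) D<y)
      ... | inj₁ le        = le
      ... | inj₂ (inj₁ le) = contradiction (subst (λ k → k + n ≤ r y + D) a≡D le)
                               (<⇒≱ (subst (r y + D <_) (+-comm n D) (+-monoˡ-< D (r<n y))))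
      ... | inj₂ (inj₂ le) = contradiction (subst₂ (λ k l → r x + k ≤ l + D) n≡2D a≡D le)
                               (<⇒≱ (m<n+m (D + D) 0<x))
    four : ∀ v → v ∈ₛ S → v ∈ (o ∷ x ∷ a ∷ y ∷ [])
    four v v∈ with D <? r v | 0 <? r v | r v + D <? n
    ... | yes D<v | _ | _ = Any.there (Any.there (Any.there (Any.here
            (r-injective (trans (antipodal (near .proj₂) (v∈ , D<v)) (sym (antipodal (near .proj₂) (y∈ , D<y))))))))
    ... | no _ | no r≯0 | _ = Any.here (r-injective (trans (n≤0⇒n≡0 (≮⇒≥ r≯0)) (sym r-origin)))
    ... | no _ | yes 0<v | yes v+D<n = Any.there (Any.here (r-injective (+-cancelʳ-≡ D _ _
            (trans (sym (antipodal (v∈ , 0<v , v+D<n) (y∈ , D<y))) (antipodal (near .proj₂) (y∈ , D<y))))))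
    ... | no D≮v | yes _ | no v+D≮n = Any.there (Any.there (Any.here (r-injective (trans
            (≤-antisym (≮⇒≥ D≮v) (+-cancelʳ-≤ D D (r v) (subst (_≤ r v + D) n≡2D (≮⇒≥ v+D≮n)))) (sym a≡D)))))

module Cliques {m n : ℕ} (3≤n : 3 ≤ n) (f : Fin m ↣ Fin n)
               (from : Fin n → Fin m) (to∘from : ∀ k → Injection.to f (from k) ≡ k) (d : ℕ) where

  open Arcs 3≤n f
  open Full 3≤n f from to∘from d

  module _ (o : Fin m) where

    r : Fin m → ℕ
    r v = (pos v + (n ∸ pos o)) % n

    r<n : ∀ v → r v < n
    r<n v = m%n<n _ n

    r-origin : r o ≡ 0
    r-origin = trans (cong (_% n) (m+[n∸m]≡n (<⇒≤ (pos<n o)))) (n%n≡0 n)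

    r-injective : ∀ {u v} → r u ≡ r v → u ≡ v
    r-injective {u} {v} eq = pos-injective (%-cancelˡ-< n (n ∸ pos o) (pos<n u) (pos<n v)
      (trans (cong (_% n) (+-comm _ (pos u))) (trans eq (cong (_% n) (+-comm (pos v) _)))))

    increasing-unique : ∀ {u v w} → r u < r v → r v < r w → Unique (u ∷ v ∷ w ∷ [])
    increasing-unique u<v v<w = (apart u<v ∷ apart (<-trans u<v v<w) ∷ []) ∷ (apart v<w ∷ []) ∷ [] ∷ []
      where
      apart : ∀ {x y} → r x < r y → x ≢ y
      apart x<y refl = <-irrefl refl x<y

    -- The shortest path through the three elements stays within D steps of its base b, so in terms
    -- of `r` it is a window starting at `r b`.
    triples : ∀ {S} → IsClique H 3 d S → ∀ {u v w} → u ∈ₛ S → v ∈ₛ S → w ∈ₛ S → r u < r v → r v < r w →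
              r w ≤ r u + D ⊎ r v + n ≤ r w + D ⊎ r u + n ≤ r v + D
    triples clique {u} {v} {w} u∈ v∈ w∈ u<v v<w
      with ℓ , p , sp , ℓ≤d , T⊆p ← clique (fromVec (u ∷ v ∷ w ∷ []))
                                (λ x∈ → All.lookup (u∈ ∷ v∈ ∷ w∈ ∷ []) (∈-fromVec⁻ _ x∈))
                                (∣fromVec∣ (increasing-unique u<v v<w))
      with b , near ← orient-base (path-oriented (sp .proj₂ .proj₂ .proj₁)) =
      three-in-window D<n (r<n b) (offset-≤ u∈p) (offset-≤ v∈p) (offset-≤ w∈p)
        (r-offset u∈p) (r-offset v∈p) (r-offset w∈p) u<v v<w
      where
      u∈p = T⊆p (∈-fromVec⁺ (u ∷ v ∷ w ∷ []) (Any.here refl))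
      v∈p = T⊆p (∈-fromVec⁺ (u ∷ v ∷ w ∷ []) (Any.there (Any.here refl)))
      w∈p = T⊆p (∈-fromVec⁺ (u ∷ v ∷ w ∷ []) (Any.there (Any.there (Any.here refl))))
      offset-≤ : ∀ {x} (x∈p : x ∈ p) → near x∈p .proj₁ ≤ D
      offset-≤ x∈p = ≤-trans (near x∈p .proj₂ .proj₁) (short p sp ℓ≤d)
      r-offset : ∀ {x} (x∈p : x ∈ p) → r x ≡ (r b + near x∈p .proj₁) % n
      r-offset {x} x∈p with j , _ , ss ← near x∈p = begin
        (pos x + k) % n             ≡⟨ cong (λ z → (z + k) % n) (Steps⇒pos ss) ⟩
        ((pos b + j) % n + k) % n   ≡⟨ %-congʳ-+ n ((pos b + j) % n) (pos b + j) k (m%n%n≡m%n (pos b + j) n) ⟩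
        (pos b + j + k) % n         ≡⟨ cong (_% n) (swap (pos b) j k) ⟩
        (pos b + k + j) % n         ≡⟨ %-congʳ-+ n (r b) (pos b + k) j (m%n%n≡m%n (pos b + k) n) ⟨
        (r b + j) % n               ∎
        where
        open ≡-Reasoning
        k = n ∸ pos o
        swap : ∀ a b c → a + b + c ≡ a + c + b
        swap = solve-∀

  clique≤ : ∀ {B S} → IsClique H 3 d S → suc D ≤ B → 4 ≤ B → ∣ S ∣ ≤ B
  clique≤ {B} {S} clique D<B 4≤B with xs , uniq , xs∈S ← elements S = go xs uniq xs∈S refl
    where
    go : ∀ {k} (xs : Vec (Fin m) k) → Unique xs → All (_∈ₛ S) xs → k ≡ ∣ S ∣ → k ≤ B
    go []            _ _ _ = z≤n
    go (_ ∷ [])      _ _ _ = ≤-trans (s≤s z≤n) 4≤B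
    go (_ ∷ _ ∷ [])  _ _ _ = ≤-trans (s≤s (s≤s z≤n)) 4≤B
    go (o ∷ u ∷ v ∷ _) ((o≢u ∷ o≢v ∷ _) ∷ (u≢v ∷ _) ∷ _) (o∈ ∷ u∈ ∷ v∈ ∷ _) k≡ =
      ≤-trans (≤-reflexive k≡) (cliqueBound third D<B 4≤B)
      where
      open Spread D<n 2D≤n S o o∈ (r o) (r<n o) (r-origin o) (r-injective o) (triples o clique)
      -- Neither u nor v is the origin, and as they differ at most one of them shares the value of
      -- y.
      third : ∀ y → ∃[ z ] z ∈ₛ S × 0 < r o z × r o z ≢ r o y
      third y with r o u ≟ r o y
      ... | no u≢y  = u , u∈ , r> (o≢u ∘ sym) , u≢y
      ... | yes u≡y = v , v∈ , r> (o≢v ∘ sym) , λ v≡y → u≢v (r-injective o (trans u≡y (sym v≡y)))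

-- Arithmetic of the criterion

-- In a cycle the shortest paths of length at most d have up to d ⊓ (n / 2) edges.
reach : ℕ → ℕ → ℕ
reach d n = d ⊓ (n / 2)

-- A colour class of C_n that meets every window of D + 1 vertices at most twice
-- has at most n * 2 / (D + 1) elements.
Room : (D n : ℕ) → Set
Room D n = n ≤ (suc D + 1) / 2 * (n * 2 / suc D)

-- Proper induced subgraphs always satisfy the equation, so C_n itself decides. If it does, then χ =
-- ⌈ω / 2⌉ ≤ c, and double counting gives n ≤ χ Q ≤ c Q.
perfect⇔room : ∀ {n} (3≤n : 3 ≤ n) d {2≤3} {3≤d+1 : True (3 ≤? d + 1)} →
               Perfect 3 d {2≤3} {3≤d+1} (cycle n 3≤n) ⇔ Room (reach d n) n
perfect⇔room {n} 3≤n d {_} {3≤d+1} = mk⇔ room perfect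
  where
  2≤d : 2 ≤ d
  2≤d = s≤s⁻¹ (≤-trans (toWitness 3≤d+1) (≤-reflexive (+-comm d 1)))

  perfect : Room (reach d n) n → Perfect 3 d {_} {3≤d+1} (cycle n 3≤n)
  perfect fits f with Fin.all? (λ q → Fin.any? λ v → Injection.to f v Fin.≟ q)
  ... | yes onto = Full.room⇒χ≡⌈ω/2⌉ 3≤n f (proj₁ ∘ onto) (proj₂ ∘ onto) d fits
  ... | no ¬onto with q , q∉ ← Fin.¬∀⟶∃¬ n _ (λ q → Fin.any? λ v → Injection.to f v Fin.≟ q) ¬onto =
    Arcs.Proper.χ≡⌈ω/2⌉-proper 3≤n f q (λ v eq → q∉ (v , eq)) d

  large : 4 ≤ n → Perfect 3 d {_} {3≤d+1} (cycle n 3≤n) → Room (reach d n) n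
  large 4≤n perf with perf {{>-nonZero (≤-trans (s≤s z≤n) 3≤n)}} (↣-id (Fin n))
  ... | χ , ω , (_ , col , _) , ((S , clique , refl) , _) , refl =
    ≤-trans (colourable⇒n≤ col) (*-monoˡ-≤ (n * 2 / suc D)
      (⌈/2⌉≤ {∣ S ∣} {c} (Cliques.clique≤ 3≤n (↣-id (Fin n)) id (λ _ → refl) d clique (≤⌈/2⌉*2 (suc D)) 4≤2c)))
    where
    open Full 3≤n (↣-id (Fin n)) id (λ _ → refl) d using (D; c; colourable⇒n≤)
    2≤D : 2 ≤ D
    2≤D = ⊓-glb 2≤d (/-monoˡ-≤ 2 4≤n)
    4≤2c : 4 ≤ c * 2
    4≤2c = *-monoˡ-≤ 2 (/-monoˡ-≤ 2 (+-monoˡ-≤ 1 (s≤s 2≤D)))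

  room : Perfect 3 d {_} {3≤d+1} (cycle n 3≤n) → Room (reach d n) n
  room perf with m≤n⇒m<n∨m≡n 3≤n
  ... | inj₁ 4≤n = large 4≤n perf
  -- For the triangle D = 1 and c = 1, so 4 ≤ 2c fails; `Room` is just 3 ≤ 3.
  ... | inj₂ refl = subst (λ D → Room D 3) (sym (m≥n⇒m⊓n≡n (≤-trans (s≤s z≤n) 2≤d))) ≤-refl

reach-≡ : ∀ {d n} → d * 2 ≤ n → reach d n ≡ d
reach-≡ {d} {n} 2d≤n = m≤n⇒m⊓n≡m (subst (_≤ n / 2) (m*n/n≡m d 2) (/-monoˡ-≤ 2 2d≤n))

-- Rounding n * 2 / (d + 1) down loses at most d / (d + 1).
room-even : ∀ {d n} → (suc d + 1) / 2 * 2 ≡ suc (suc d) → (suc d + 1) / 2 * d ≤ n → Room d n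
room-even {d} {n} 2c≡d+2 cd≤n = *-cancelˡ-≤ (suc d) (+-cancelˡ-≤ n _ _ (begin
  suc (suc d) * n             ≡⟨ cong (_* n) 2c≡d+2 ⟨
  c * 2 * n                   ≡⟨ *-assoc c 2 n ⟩
  c * (2 * n)                 ≡⟨ cong (c *_) (*-comm 2 n) ⟩
  c * (n * 2)                 ≡⟨ cong (c *_) (m≡m%n+[m/n]*n (n * 2) (suc d)) ⟩
  c * (n * 2 % suc d + q * suc d) ≡⟨ *-distribˡ-+ c (n * 2 % suc d) (q * suc d) ⟩
  c * (n * 2 % suc d) + c * (q * suc d)
    ≤⟨ +-monoˡ-≤ _ (≤-trans (*-monoʳ-≤ c (s≤s⁻¹ (m%n<n (n * 2) (suc d)))) cd≤n) ⟩
  n + c * (q * suc d)         ≡⟨ cong (n +_) (*-assoc c q (suc d)) ⟨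
  n + c * q * suc d           ≡⟨ cong (n +_) (*-comm (c * q) (suc d)) ⟩
  n + suc d * (c * q)         ∎))
  where
  open ≤-Reasoning
  c = (suc d + 1) / 2
  q = n * 2 / suc d

-- Here Q = ⌊2n / 2c⌋ = ⌊n / c⌋ and there are c colours, so `Room` says n ≤ c ⌊n / c⌋.
room-odd : ∀ {d n} c .{{_ : NonZero c}} → c * 2 ≡ suc d → Room d n ⇔ c ∣ n
room-odd {d} {n} c@(suc _) refl = mk⇔
  (λ fits → subst (c ∣_)
    (≤-antisym (≤-trans (≤-reflexive (*-comm c (n / c))) (m/n*n≤m n c)) (subst (n ≤_) c*⌊n/c⌋ fits))
    (m∣m*n (n / c)))
  (λ c∣n → ≤-reflexive (sym (trans c*⌊n/c⌋ (m*[n/m]≡n c∣n))))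
  where
  c≡ : (c * 2 + 1) / 2 ≡ c
  c≡ = trans (+-distrib-/-∣ˡ {c * 2} 1 {2} (n∣m*n c)) (trans (cong (_+ 0) (m*n/n≡m c 2)) (+-identityʳ c))
  c*⌊n/c⌋ : (c * 2 + 1) / 2 * (n * 2 / (c * 2)) ≡ c * (n / c)
  c*⌊n/c⌋ = cong₂ _*_ c≡ (m*n/o*n≡m/o n 2 c)

-- Small n by evaluation, large n by parity of d

room? : ∀ D n → Dec (Room D n)
room? D n = n ≤? _

-- The implicit argument is found by evaluation: both implications are decided for every n < N.
table : ∀ d {P : Pred ℕ 0ℓ} (P? : Decidable P) N →
        {True (allUpTo? (λ n → (room? (reach d n) n →-dec P? n) ×-dec (P? n →-dec room? (reach d n) n)) N)} →
        ∀ {n} → n < N → Room (reach d n) n ⇔ P n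
table d P? N {checked} n<N = let to , from = toWitness checked n<N in mk⇔ to from

even-case : ∀ d {P : Pred ℕ 0ℓ} N → {True (d * 2 ≤? N)} → {True ((suc d + 1) / 2 * d ≤? N)} →
  (suc d + 1) / 2 * 2 ≡ suc (suc d) →
  (∀ {n} → n < N → Room (reach d n) n ⇔ P n) → (∀ {n} → n ≥ N → P n) → ∀ {n} → Room (reach d n) n ⇔ P n
even-case d N {2d≤N} {cd≤N} 2c≡d+2 small big {n} with <-≤-connex n N
... | inj₁ n<N = small n<N
... | inj₂ N≤n = mk⇔ (λ _ → big N≤n) λ _ → subst (λ D → Room D n) (sym (reach-≡ {d} (≤-trans (toWitness 2d≤N) N≤n)))
                   (room-even {d} 2c≡d+2 (≤-trans (toWitness cd≤N) N≤n))

odd-case : ∀ d c .{{_ : NonZero c}} {P : Pred ℕ 0ℓ} N → {True (d * 2 ≤? N)} → c * 2 ≡ suc d →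
  (∀ {n} → n < N → Room (reach d n) n ⇔ P n) →
  ∀ {n} → Room (reach d n) n ⇔ (n < N × P n ⊎ n ≥ N × c ∣ n)
odd-case d c {P} N {2d≤N} 2c≡d+1 small {n} = mk⇔ fwd bwd
  where
  open Equivalence
  big : n ≥ N → Room (reach d n) n ⇔ c ∣ n
  big N≤n = subst (λ D → Room D n ⇔ c ∣ n) (sym (reach-≡ {d} (≤-trans (toWitness 2d≤N) N≤n))) (room-odd {d} c 2c≡d+1)
  fwd : Room (reach d n) n → n < N × P n ⊎ n ≥ N × c ∣ n
  fwd fits with <-≤-connex n N
  ... | inj₁ n<N = inj₁ (n<N , small n<N .to fits)
  ... | inj₂ N≤n = inj₂ (N≤n , big N≤n .to fits)
  bwd : n < N × P n ⊎ n ≥ N × c ∣ n → Room (reach d n) n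
  bwd (inj₁ (n<N , p)) = small n<N .from p
  bwd (inj₂ (N≤n , c∣n)) = big N≤n .from c∣n

≥⇒∉ : ∀ {N n} {xs : List ℕ} → List.All (_< N) xs → n ≥ N → n ∉ xs
≥⇒∉ xs<N n≥N n∈xs = <⇒≱ (List.lookup xs<N n∈xs) n≥N

corollary5p14 : ∀ (n : ℕ) (3≤n : 3 ≤ n) →
    Perfect 3 2 (cycle n 3≤n)
    × (Perfect 3 3 (cycle n 3≤n) ⇔ (n < 7 ⊎ (n ≥ 7 × 2 ∣ n)))
    × (Perfect 3 4 (cycle n 3≤n) ⇔ n ≢ 7)
    × (Perfect 3 5 (cycle n 3≤n) ⇔ ((n < 10 × n ≢ 7) ⊎ (n ≥ 10 × 3 ∣ n)))
    × (Perfect 3 6 (cycle n 3≤n) ⇔ n ∉ 7 ∷ 10 ∷ 11 ∷ 13 ∷ 17 ∷ [])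
    × (Perfect 3 7 (cycle n 3≤n) ⇔
    ((n < 14 × n ∉ 7 ∷ 10 ∷ 11 ∷ 13 ∷ []) ⊎ (n ≥ 14 × 4 ∣ n)))
    × (Perfect 3 8 (cycle n 3≤n) ⇔
    n ∉ 7 ∷ 10 ∷ 11 ∷ 13 ∷ 14 ∷ 15 ∷ 16 ∷ 17 ∷ 21 ∷ 22 ∷ 26 ∷ 31 ∷ [])
    × (Perfect 3 9 (cycle n 3≤n) ⇔
    ((n < 18 × n ∉ 7 ∷ 10 ∷ 11 ∷ 13 ∷ 14 ∷ 15 ∷ 16 ∷ 17 ∷ []) ⊎ (n ≥ 18 × 5 ∣ n)))
corollary5p14 n 3≤n =
    -- For even d the table stops at N = (d / 2 + 1) d, where `room-even` takes over; for odd d it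
    -- stops at the threshold in the statement, which is at least 2d.
    Equivalence.from (perfect 2 (even-case 2 4 refl (table 2 always 4) (λ _ → tt))) tt
  , perfect 3 (mk⇔ (map₁ proj₁) (map₁ (_, tt)) ⇔-∘ odd-case 3 2 7 refl (table 3 always 7))
  , perfect 4 (even-case 4 12 refl (table 4 ≢7? 12) (λ { 12≤7 refl → <⇒≱ (toWitness {a? = 7 <? 12} tt) 12≤7 }))
  , perfect 5 (odd-case 5 3 10 refl (table 5 ≢7? 10))
  , perfect 6 (even-case 6 24 refl (table 6 (_∉? _) 24) (≥⇒∉ (toWitness {a? = List.all? (_<? 24) _} tt)))
  , perfect 7 (odd-case 7 4 14 refl (table 7 (_∉? _) 14))
  , perfect 8 (even-case 8 40 refl (table 8 (_∉? _) 40) (≥⇒∉ (toWitness {a? = List.all? (_<? 40) _} tt)))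
  , perfect 9 (odd-case 9 5 18 refl (table 9 (_∉? _) 18))
  where
  open ListMembership _≟_ using (_∉?_)
  perfect : ∀ d {2≤3 3≤d+1} {B : Set} → Room (reach d n) n ⇔ B → Perfect 3 d {2≤3} {3≤d+1} (cycle n 3≤n) ⇔ B
  perfect d {2≤3} {3≤d+1} room⇔B = room⇔B ⇔-∘ perfect⇔room 3≤n d {2≤3} {3≤d+1}
  always : Decidable {A = ℕ} (λ _ → ⊤)
  always _ = yes tt
  ≢7? : Decidable (_≢ 7)
  ≢7? n = ¬? (n ≟ 7)
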